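{- Let $m \geq 0$, $n \geq 1$ be integers and let $c = (c^t; c^b)$ be a sorted deterministically recurrent configuration on $K_{m,n}^0$. Run the following algorithm: let $T$ be the stack $(c^t_1, \ldots, c^t_m, n-1)$ and $B$ the stack $(c^b_1, \ldots, c^b_n)$, each with head its first (smallest) element, and let $w$ be the empty word. While both $T$ and $B$ are non-empty: (a) while $\mathrm{head}(T) > 0$ and $\mathrm{head}(B) > 0$, append $U$ to $w$ and decrease every entry of $T$ and of $B$ by $1$; (b) then, if $0 = \mathrm{head}(T) < \mathrm{head}(B)$, remove the head of $T$, append $H^E$ to $w$, and decrease every entry of $B$ by $1$; else if $0 = \mathrm{head}(B) < \mathrm{head}(T)$, remove the head of $B$, append $H^N$ to $w$, and decrease every entry of $T$ by $1$; else (both heads equal $0$) remove the heads of both $T$ and $B$ and append $D$ to $w$. After the loop, delete the final step (a $D$) of $w$ and output the resulting word $w(c)$. Then $w(c) = \Xi(\Phi(c))$; that is, $c \mapsto w(c)$ is the bijection $\Xi \circ \Phi$ from sorted deterministically recurrent configurations on $K_{m,n}^0$ to $\mathrm{Motz}_{m,n-1}$. Moreover, $\mathrm{level}(c) = \mathrm{Area}(w(c))$.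
   Context: $K_{m,n}^0$ is the complete bipartite graph with "top" vertices $v^t_0, \ldots, v^t_m$ and "bottom" vertices $v^b_1, \ldots, v^b_n$, with an edge between every top and every bottom vertex; $v^t_0$ is the sink. A configuration is a vector $c = (c^t_1, \ldots, c^t_m; c^b_1, \ldots, c^b_n)$ of non-negative integers; it is sorted if $c^t$, $c^b$ are weakly increasing, stable if $c^t_i < n$ and $c^b_j < m+1$ for all $i,j$. Abelian sandpile model (ASM): an unstable non-sink vertex topples by sending one grain to each neighbour (bottom vertices also to the sink); grains sent to the sink disappear. In the Markov chain on stable configurations which adds a grain to a uniformly random non-sink vertex and stabilises by the ASM, a stable configuration is deterministically recurrent if it is a recurrent state. The level is $\mathrm{level}(c) := \sum_i c^t_i + \sum_j c^b_j - mn$. Labelled Motzkin paths: words in steps $U=(1,1)$, $D=(1,-1)$ and horizontal steps $H^N, H^E$ (both $=(1,0)$), starting and ending at height $0$ and never going below the $x$-axis; $\mathrm{Area}(w)$ is the area between the path and the $x$-axis. $\mathrm{Motz}_{m,n-1}$ is the set of such paths with $m+n-1$ steps, exactly $m$ of which are $U$ or $H^E$. A parallelogram polyomino in the box $[0,m+1]\times[0,n]$ is the set of unit cells between two lattice paths $\mathcal{U}$ (upper) and $\mathcal{L}$ (lower) from $(0,0)$ to $(m+1,n)$ with steps $N=(0,1)$, $E=(1,0)$, meeting only at their endpoints; necessarily $\mathcal{U} = (N, u_1, \ldots, u_{m+n-1}, E)$ and $\mathcal{L} = (E, \ell_1, \ldots, \ell_{m+n-1}, N)$. The map $\Xi$ sends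 such a polyomino to $w_1 \cdots w_{m+n-1}$ with $w_i = U$ if $(u_i,\ell_i) = (N,E)$, $w_i = H^N$ if $(u_i,\ell_i)=(N,N)$, $w_i = H^E$ if $(u_i,\ell_i) = (E,E)$, $w_i = D$ if $(u_i,\ell_i) = (E,N)$; it is known to be a bijection onto $\mathrm{Motz}_{m,n-1}$. The Dukes–Le Borgne map $\Phi$: for a sorted stable $c$, $\mathcal{U}(c^t)$ is the path from $(0,0)$ to $(m+1,n)$ whose $E$ steps occur at heights $1+c^t_1, \ldots, 1+c^t_m, n$, and $\mathcal{L}(c^b)$ the path from $(0,0)$ to $(m+1,n)$ whose $N$ steps occur at $x$-coordinates $1+c^b_1, \ldots, 1+c^b_n$; $\Phi(c)$ is the polyomino between them. It is known that $\Phi$ is a bijection from sorted deterministically recurrent configurations on $K_{m,n}^0$ to parallelogram polyominoes in $[0,m+1]\times[0,n]$. -}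

module Defs where

open import Data.Bool.Base using (if_then_else_)
open import Data.Fin.Base using (Fin; zero; suc)
import Data.Fin.Properties as Fin
open import Data.Integer.Base as ℤ using (ℤ; 0ℤ; 1ℤ; -1ℤ)
open import Data.List.Base as List using (List; []; _∷_; _++_)
open import Data.Nat.Base
open import Data.Nat.ListAction using (sum)
open import Data.Nat.Induction using (<-wellFounded)
open import Data.Nat.Properties
open import Data.Nat.Tactic.RingSolver using (solve-∀)
open import Data.Product as Product using (Σ; Σ-syntax; ∃; ∃-syntax; _×_; _,_; proj₁; proj₂)
import Data.Product.Properties as Product
open import Data.Rational.Unnormalised.Base as ℚ using (ℚᵘ; 0ℚᵘ)
open import Data.Sum.Base using (_⊎_; inj₁; inj₂)
open import Data.Vec.Base as Vec using (Vec; []; _∷_; _∷ʳ_; lookup; updateAt)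
import Data.Vec.Properties as Vec
open import Data.Vec.Relation.Unary.Linked using (Linked)
open import Function.Base using (_on_; _∘_)
open import Function.Definitions using (Bijective)
open import Induction.WellFounded using (Acc; acc)
open import Relation.Binary.Construct.Closure.ReflexiveTransitive using (Star; ε; _◅_)
open import Relation.Binary.Definitions using (DecidableEquality)
open import Relation.Binary.PropositionalEquality
open import Relation.Nullary.Decidable.Core using (does; yes; no)

private variable
  m n k l : ℕ

-- Non-sink vertices: `inj₁ i` is a top vertex, `inj₂ j` a bottom vertex.
-- The sink is one further top vertex, adjacent to all the bottom vertices.
Vertex : ℕ → ℕ → Set
Vertex m n = Fin m ⊎ Fin n

Config : ℕ → ℕ → Set
Config m n = Vec ℕ m × Vec ℕ n

infix 4 _≟ᶜ_
_≟ᶜ_ : DecidableEquality (Config m n)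
_≟ᶜ_ = Product.≡-dec (Vec.≡-dec _≟_) (Vec.≡-dec _≟_)

degree : Vertex m n → ℕ
degree {n = n} (inj₁ _) = n
degree {m = m} (inj₂ _) = suc m

grains : Config m n → Vertex m n → ℕ
grains (t , b) (inj₁ i) = lookup t i
grains (t , b) (inj₂ j) = lookup b j

Sorted : Config m n → Set
Sorted (t , b) = Linked _≤_ t × Linked _≤_ b

Stable : Config m n → Set
Stable c = ∀ v → grains c v < degree v

Unstable : Config m n → Vertex m n → Set
Unstable c v = degree v ≤ grains c v

addGrain : Vertex m n → Config m n → Config m n
addGrain (inj₁ i) (t , b) = updateAt t i suc , b
addGrain (inj₂ j) (t , b) = t , updateAt b j suc

-- A toppling bottom vertex loses m + 1 grains, one of which vanishes in the
-- sink.
topple : Vertex m n → Config m n → Config m n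
topple {n = n} (inj₁ i) (t , b) = updateAt t i (_∸ n) , Vec.map suc b
topple {m = m} (inj₂ j) (t , b) = Vec.map suc t , updateAt b j (_∸ suc m)

infix 4 _⟶_ _⟶*_
data _⟶_ {m n} (c : Config m n) : Config m n → Set where
  topples : ∀ v → Unstable c v → c ⟶ topple v c

_⟶*_ : Config m n → Config m n → Set
_⟶*_ = Star _⟶_

private
  -- Every legal toppling strictly decreases this weight.
  weight : Config m n → ℕ
  weight {m} (t , b) = suc (suc m) * Vec.sum t + suc m * Vec.sum b

  swap : ∀ p q r → p + (q + r) ≡ q + (p + r)
  swap = solve-∀

  sum-map-suc : (xs : Vec ℕ k) → Vec.sum (Vec.map suc xs) ≡ k + Vec.sum xs
  sum-map-suc []       = refl
  sum-map-suc {k = suc k} (x ∷ xs) rewrite sum-map-suc xs =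
    cong suc (swap x k (Vec.sum xs))

  sum-remove : ∀ (xs : Vec ℕ k) i d → d ≤ lookup xs i →
               Vec.sum xs ≡ d + Vec.sum (updateAt xs i (_∸ d))
  sum-remove (x ∷ xs) zero d d≤x = begin
    x + Vec.sum xs              ≡⟨ cong (_+ Vec.sum xs) (m+[n∸m]≡n d≤x) ⟨
    d + (x ∸ d) + Vec.sum xs    ≡⟨ +-assoc d (x ∸ d) (Vec.sum xs) ⟩
    d + (x ∸ d + Vec.sum xs)    ∎
    where open ≡-Reasoning
  sum-remove (x ∷ xs) (suc i) d d≤ rewrite sum-remove xs i d d≤ =
    swap x d (Vec.sum (updateAt xs i (_∸ d)))

  topple-weight : .{{_ : NonZero n}} → ∀ (c : Config m n) v →
                  Unstable c v → weight (topple v c) < weight c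
  topple-weight {n} {m} (t , b) (inj₁ i) u
    rewrite sum-map-suc b | sum-remove t i n u =
    subst (weight′ <_) (eq m n s (Vec.sum b)) (m<m+n weight′ (>-nonZero⁻¹ n))
    where
    s = Vec.sum (updateAt t i (_∸ n))
    weight′ = suc (suc m) * s + suc m * (n + Vec.sum b)
    eq : ∀ m n s b → suc (suc m) * s + suc m * (n + b) + n
                   ≡ suc (suc m) * (n + s) + suc m * b
    eq = solve-∀
  topple-weight {n} {m} (t , b) (inj₂ j) u
    rewrite sum-map-suc t | sum-remove b j (suc m) u =
    subst (weight′ <_) (eq m (Vec.sum t) s) (m<m+n weight′ z<s)
    where
    s = Vec.sum (updateAt b j (_∸ suc m))
    weight′ = suc (suc m) * (m + Vec.sum t) + suc m * s
    eq : ∀ m t s → suc (suc m) * (m + t) + suc m * s + 1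
                 ≡ suc (suc m) * t + suc m * (suc m + s)
    eq = solve-∀

  findUnstable : (c : Config m n) → ∃ (Unstable c) ⊎ Stable c
  findUnstable {m} {n} c with Fin.any? (λ i → n ≤? grains c (inj₁ i))
  ... | yes (i , u) = inj₁ (inj₁ i , u)
  ... | no ¬top with Fin.any? (λ j → suc m ≤? grains c (inj₂ j))
  ...   | yes (j , u) = inj₁ (inj₂ j , u)
  ...   | no ¬bot = inj₂ λ where
            (inj₁ i) → ≰⇒> (¬top ∘ (i ,_))
            (inj₂ j) → ≰⇒> (¬bot ∘ (j ,_))

  stabilise : .{{_ : NonZero n}} → ∀ (c : Config m n) →
              Acc _<_ (weight c) → ∃[ d ] (c ⟶* d × Stable d)
  stabilise c (acc rs) with findUnstable c
  ... | inj₂ s       = c , ε , s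
  ... | inj₁ (v , u) =
    Product.map₂ (Product.map₁ (topples v u ◅_))
      (stabilise (topple v c) (rs (topple-weight c v u)))

-- The result of stabilisation does not depend on the order of the topplings,
-- so it is harmless that one order is chosen here.
stabilisation : .{{_ : NonZero n}} → ∀ (c : Config m n) →
                ∃[ d ] (c ⟶* d × Stable d)
stabilisation c = stabilise c (<-wellFounded _)

stab : .{{_ : NonZero n}} → Config m n → Config m n
stab c = proj₁ (stabilisation c)

vertices : ∀ m n → List (Vertex m n)
vertices m n = List.map inj₁ (List.allFin m) ++ List.map inj₂ (List.allFin n)

next : .{{_ : NonZero n}} → Config m n → Vertex m n → Config m n
next c v = stab (addGrain v c)

-- The number of sequences of τ vertices for which the trajectory starting at
-- d does not visit c at any of the times 1, …, τ.
avoiding : .{{_ : NonZero n}} → Config m n → ℕ → Config m n → ℕ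
avoiding             c zero    d = 1
avoiding {n} {m = m} c (suc τ) d =
  sum (List.map
    (λ v → if does (next d v ≟ᶜ c) then 0 else avoiding c τ (next d v))
    (vertices m n))

-- The probability that the chain started at c has not returned to c by time
-- τ: the (m + n) ^ τ sequences of τ vertices are equally likely.
noReturn : .{{_ : NonZero n}} → Config m n → ℕ → ℚᵘ
noReturn {n} {m = m} c τ = (ℤ.+ avoiding c τ c) ℚ./ ((m + n) ^ τ)
  where instance
    total≢0 : NonZero ((m + n) ^ τ)
    total≢0 = m^n≢0 (m + n) τ
      {{>-nonZero (≤-trans (>-nonZero⁻¹ n) (m≤n+m n m))}}

-- Recurrence: the chain returns with probability 1, that is, the probability
-- of no return by time τ (which is weakly decreasing in τ) tends to 0.
DeterministicallyRecurrent : .{{_ : NonZero n}} → Config m n → Set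
DeterministicallyRecurrent c =
  Stable c × (∀ δ → 0ℚᵘ ℚ.< δ → ∃[ τ ] noReturn c τ ℚ.< δ)

SortedRecurrent : .{{_ : NonZero n}} → Config m n → Set
SortedRecurrent c = Sorted c × DeterministicallyRecurrent c

level : Config m n → ℤ
level {m} {n} (t , b) = ℤ.+ (Vec.sum t + Vec.sum b) ℤ.- ℤ.+ (m * n)

data Step : Set where
  U D Hᴺ Hᴱ : Step

rise : Step → ℤ
rise U  = 1ℤ
rise D  = -1ℤ
rise Hᴺ = 0ℤ
rise Hᴱ = 0ℤ

-- Words that lead from the given height to height 0 and never go below 0.
data MotzkinFrom : ℕ → List Step → Set where
  []    : MotzkinFrom 0 []
  up    : ∀ {h w} → MotzkinFrom (suc h) w → MotzkinFrom h (U ∷ w)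
  down  : ∀ {h w} → MotzkinFrom h w → MotzkinFrom (suc h) (D ∷ w)
  flatᴺ : ∀ {h w} → MotzkinFrom h w → MotzkinFrom h (Hᴺ ∷ w)
  flatᴱ : ∀ {h w} → MotzkinFrom h w → MotzkinFrom h (Hᴱ ∷ w)

#U+Hᴱ : List Step → ℕ
#U+Hᴱ []       = 0
#U+Hᴱ (U ∷ w)  = suc (#U+Hᴱ w)
#U+Hᴱ (Hᴱ ∷ w) = suc (#U+Hᴱ w)
#U+Hᴱ (D ∷ w)  = #U+Hᴱ w
#U+Hᴱ (Hᴺ ∷ w) = #U+Hᴱ w

Motz : ℕ → ℕ → List Step → Set
Motz m k w = MotzkinFrom 0 w × List.length w ≡ m + k × #U+Hᴱ w ≡ m

-- Each step, having width 1, contributes the trapezium between it and the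
-- x-axis.
areaFrom : ℤ → List Step → ℚᵘ
areaFrom h []      = 0ℚᵘ
areaFrom h (s ∷ w) = (h ℤ.+ h′) ℚ./ 2 ℚ.+ areaFrom h′ w
  where h′ = h ℤ.+ rise s

Area : List Step → ℚᵘ
Area = areaFrom 0ℤ

data Dir : Set where
  N E : Dir

Point : Set
Point = ℕ × ℕ

-- The end point of a lattice path that starts at (0 , 0).
end : List Dir → Point
end []      = 0 , 0
end (N ∷ p) = Product.map₂ suc (end p)
end (E ∷ p) = Product.map₁ suc (end p)

_LiesOn_ : Point → List Dir → Set
x LiesOn p = ∃[ i ] x ≡ end (List.take i p)

-- A polyomino is given by its bounding paths (upper , lower).  Two such paths
-- that meet at all meet at a lattice point, so it suffices to consider these.
record IsPolyomino (m n : ℕ) (paths : List Dir × List Dir) : Set where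
  private
    upper = proj₁ paths
    lower = proj₂ paths
  field
    upper-end : end upper ≡ (suc m , n)
    lower-end : end lower ≡ (suc m , n)
    above     : ∀ {x y y′} → (x , y) LiesOn upper → (x , y′) LiesOn lower → y′ ≤ y
    meet      : ∀ {x} → x LiesOn upper → x LiesOn lower →
                x ≡ (0 , 0) ⊎ x ≡ (suc m , n)

Polyomino : ℕ → ℕ → Set
Polyomino m n = Σ (List Dir × List Dir) (IsPolyomino m n)

dropLast : ∀ {A : Set} → List A → List A
dropLast []           = []
dropLast (x ∷ [])     = []
dropLast (x ∷ y ∷ xs) = x ∷ dropLast (y ∷ xs)

inner : List Dir → List Dir
inner p = dropLast (List.drop 1 p)

-- First argument from the upper path, second from the lower path.
combine : Dir → Dir → Step
combine N E = U
combine N N = Hᴺ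
combine E E = Hᴱ
combine E N = D

Ξ : Polyomino m n → List Step
Ξ ((u , l) , _) = List.zipWith combine (inner u) (inner l)

-- `stairs a b e x hs` is the path, started at coordinate x in direction a,
-- whose b steps occur at the a-coordinates hs (weakly increasing) and which
-- ends at a-coordinate e.
stairs : Dir → Dir → ℕ → ℕ → Vec ℕ k → List Dir
stairs a b e x []       = List.replicate (e ∸ x) a
stairs a b e x (h ∷ hs) = List.replicate (h ∸ x) a ++ b ∷ stairs a b e h hs

Φ : Config m n → List Dir × List Dir
Φ {m} {n} (t , b) =
  stairs N E n 0 (Vec.map suc t ∷ʳ n) , stairs E N (suc m) 0 (Vec.map suc b)

-- `run T B` is the word appended by the main loop; `loop` performs phases (a)
-- and (b) on stacks with heads t and b.  The stacks are weakly increasing for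
-- sorted input, so `pred` is only ever applied to positive entries.
mutual
  run : Vec ℕ k → Vec ℕ l → List Step
  run []      _       = []
  run (_ ∷ _) []      = []
  run (t ∷ T) (b ∷ B) = loop t T b B

  loop : ℕ → Vec ℕ k → ℕ → Vec ℕ l → List Step
  loop (suc t) T (suc b) B = U ∷ loop t (Vec.map pred T) b (Vec.map pred B)
  loop zero    T (suc b) B = Hᴱ ∷ run T (b ∷ Vec.map pred B)
  loop (suc t) T zero    B = Hᴺ ∷ run (t ∷ Vec.map pred T) B
  loop zero    T zero    B = D ∷ run T B

fullWord : Config m n → List Step
fullWord {n = n} (t , b) = run (t ∷ʳ (n ∸ 1)) b

word : Config m n → List Step
word c = dropLast (fullWord c)

-- A bijection from { x ∣ P x } to { y ∣ Q y }: elements of these subsets are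
-- compared without regard to the proofs of P and Q.
BijectionBetween : ∀ {A B : Set} → (A → Set) → (B → Set) → (A → B) → Set
BijectionBetween P Q f =
  Σ[ maps ∈ (∀ {x} → P x → Q (f x)) ]
    Bijective {A = Σ _ P} {B = Σ _ Q} (_≡_ on proj₁) (_≡_ on proj₁)
      (Product.map f maps)

{-# OPTIONS --safe #-}

-- The run of the algorithm is determined by its word: read backwards, the word
-- prescribes how the two stacks are built up from the empty ones. The relation
-- `Parse` expresses this, and the area, the polyomino and the injectivity are
-- read off by induction on it. Stacks that can be parsed are recognised by the
-- condition j < h + Tᵢ or i < h + Bⱼ (indices from 0), which at height h = 0
-- says that no forbidden subconfiguration exists: i + 1 top vertices with at
-- most j grains together with j + 1 bottom vertices with at most i grains.
--
-- This condition characterises recurrence. It holds for the maximal stable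
-- configuration and is preserved by the chain, so a configuration violating it
-- is, with a fixed positive probability, never revisited. Conversely, if it
-- holds for c, then after firing the sink every vertex can topple once (Dhar's
-- burning algorithm), which leads back to c. Hence c is reached from c with
-- many grains added, and so from every stable configuration, within a bounded
-- number of steps, and the probability of no return decays geometrically.

module Submission where

open import Defs
open import Data.Bool.Base using (if_then_else_)
open import Data.Empty using (⊥)
open import Data.Fin.Base as Fin using (Fin; zero; suc; toℕ; fromℕ; fromℕ<; inject₁)
import Data.Fin.Properties as Fin
open import Data.Fin.Relation.Unary.Top using (view; ‵fromℕ; ‵inject₁)
open import Data.Integer.Base as ℤ using (ℤ)
import Data.Integer.Properties as ℤ
open import Data.Integer.Solver using (module +-*-Solver)
open import Data.List.Base as List using (List; []; _∷_; _++_; _∷ʳ_)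
import Data.List.Properties as List
open import Data.List.Membership.Propositional using (_∈_)
import Data.List.Membership.Propositional.Properties as ∈
open import Data.List.Relation.Unary.Any using (here; there)
open import Data.Nat.Base hiding (_/_)
open import Data.Nat.ListAction using (sum)
open import Data.Nat.Properties
open import Data.Nat.Tactic.RingSolver using (solve-∀)
open import Data.Product using (Σ-syntax; ∃-syntax; _×_; _,_; proj₁; proj₂)
open import Data.Rational.Unnormalised.Base as ℚ using (mkℚᵘ; _/_; _≃_; *≡*; *<*)
import Data.Rational.Unnormalised.Properties as ℚ
open import Data.Sum.Base as Sum using (_⊎_; inj₁; inj₂)
import Data.Sum.Properties as Sum
open import Data.Vec.Base as Vec using (Vec; []; _∷_; lookup; updateAt)
import Data.Vec.Properties as Vec
open import Data.Vec.Relation.Unary.All as All using (All; []; _∷_)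
import Data.Vec.Relation.Unary.All.Properties as All
open import Data.Vec.Relation.Unary.Linked as Linked using (Linked; []; [-]; _∷_)
import Data.Vec.Relation.Unary.Linked.Properties as Linked
open import Function.Base using (_∘_; id)
open import Relation.Binary.Construct.Closure.ReflexiveTransitive using (ε; _◅_; _◅◅_; gmap)
open import Relation.Binary.PropositionalEquality
open import Relation.Nullary.Decidable using (dec-true; dec-false)
open import Relation.Nullary using (¬_; Dec; does; yes; no; contradiction)

open +-*-Solver using (Polynomial; solve; con; _:=_; _:+_; _:-_; _:*_)

private variable
  m n k l h : ℕ
  w : List Step

-- T and B are the stacks in a run of the algorithm at a moment when the height
-- is h and the word still to be written is w ∷ʳ D.
data Parse : ∀ {k l} → ℕ → Vec ℕ (suc k) → Vec ℕ (suc l) → List Step → Set where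
  stop  : Parse 0 (0 ∷ []) (0 ∷ []) []
  up    : ∀ {T : Vec ℕ (suc k)} {B : Vec ℕ (suc l)} →
          Parse (suc h) T B w → Parse h (Vec.map suc T) (Vec.map suc B) (U ∷ w)
  down  : ∀ {T : Vec ℕ (suc k)} {B : Vec ℕ (suc l)} →
          Parse h T B w → Parse (suc h) (0 ∷ T) (0 ∷ B) (D ∷ w)
  flatᴺ : ∀ {T : Vec ℕ (suc k)} {B : Vec ℕ (suc l)} →
          Parse h T B w → Parse h (Vec.map suc T) (0 ∷ B) (Hᴺ ∷ w)
  flatᴱ : ∀ {T : Vec ℕ (suc k)} {B : Vec ℕ (suc l)} →
          Parse h T B w → Parse h (0 ∷ T) (Vec.map suc B) (Hᴱ ∷ w)

private variable
  T : Vec ℕ (suc k)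
  B : Vec ℕ (suc l)

-- Words, counts and sortedness read off a parse.

map-pred-suc : (xs : Vec ℕ k) → Vec.map pred (Vec.map suc xs) ≡ xs
map-pred-suc xs = trans (sym (Vec.map-∘ pred suc xs)) (Vec.map-id xs)

-- Each constructor inverts one step of the loop; `stop` is the state just before the final `D`,
-- which the parsed word omits.
parse⇒run : Parse h T B w → run T B ≡ w ∷ʳ D
parse⇒run stop = refl
parse⇒run (up {T = t ∷ T} {B = b ∷ B} p)
  rewrite map-pred-suc T | map-pred-suc B = cong (U ∷_) (parse⇒run p)
parse⇒run (down p) = cong (D ∷_) (parse⇒run p)
parse⇒run (flatᴺ {T = t ∷ T} p) rewrite map-pred-suc T = cong (Hᴺ ∷_) (parse⇒run p)
parse⇒run (flatᴱ {B = b ∷ B} p) rewrite map-pred-suc B = cong (Hᴱ ∷_) (parse⇒run p)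

parse⇒motzkin : Parse h T B w → MotzkinFrom h w
parse⇒motzkin stop      = []
parse⇒motzkin (up p)    = up (parse⇒motzkin p)
parse⇒motzkin (down p)  = down (parse⇒motzkin p)
parse⇒motzkin (flatᴺ p) = flatᴺ (parse⇒motzkin p)
parse⇒motzkin (flatᴱ p) = flatᴱ (parse⇒motzkin p)

-- The word prescribes the constructors one by one. The stack sizes are results of this construction
-- and are matched with m and n in `motz⇒parse`.
motzkin⇒parse : MotzkinFrom h w →
                ∃[ k ] ∃[ l ] Σ[ T ∈ Vec ℕ (suc k) ] Σ[ B ∈ Vec ℕ (suc l) ] Parse h T B w
motzkin⇒parse []     = _ , _ , _ , _ , stop
motzkin⇒parse (up p) with _ , _ , _ , _ , q ← motzkin⇒parse p = _ , _ , _ , _ , up q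
motzkin⇒parse (down p) with _ , _ , _ , _ , q ← motzkin⇒parse p = _ , _ , _ , _ , down q
motzkin⇒parse (flatᴺ p) with _ , _ , _ , _ , q ← motzkin⇒parse p = _ , _ , _ , _ , flatᴺ q
motzkin⇒parse (flatᴱ p) with _ , _ , _ , _ , q ← motzkin⇒parse p = _ , _ , _ , _ , flatᴱ q

parse-injective : {T T′ : Vec ℕ (suc k)} {B B′ : Vec ℕ (suc l)} →
                  Parse h T B w → Parse h T′ B′ w → T ≡ T′ × B ≡ B′
parse-injective stop stop = refl , refl
parse-injective (up p) (up q) with refl , refl ← parse-injective p q = refl , refl
parse-injective (down p) (down q) with refl , refl ← parse-injective p q = refl , refl
parse-injective (flatᴺ p) (flatᴺ q) with refl , refl ← parse-injective p q = refl , refl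
parse-injective (flatᴱ p) (flatᴱ q) with refl , refl ← parse-injective p q = refl , refl

-- The top stack loses an entry at each `D` and each `Hᴱ`, and a path from height h to 0 has h more
-- `D` than `U`.
parse-#U+Hᴱ : {T : Vec ℕ (suc k)} → Parse h T B w → #U+Hᴱ w + h ≡ k
parse-#U+Hᴱ stop = refl
parse-#U+Hᴱ {h = h} {w = U ∷ w} (up p) = trans (sym (+-suc (#U+Hᴱ w) h)) (parse-#U+Hᴱ p)
parse-#U+Hᴱ {h = suc h} {w = D ∷ w} (down p) = trans (+-suc (#U+Hᴱ w) h) (cong suc (parse-#U+Hᴱ p))
parse-#U+Hᴱ (flatᴺ p) = parse-#U+Hᴱ p
parse-#U+Hᴱ (flatᴱ p) = cong suc (parse-#U+Hᴱ p)

parse-length : {T : Vec ℕ (suc k)} {B : Vec ℕ (suc l)} →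
               Parse h T B w → List.length w + h ≡ k + l
parse-length stop = refl
parse-length {h = h} {w = U ∷ w} (up p) = trans (sym (+-suc (List.length w) h)) (parse-length p)
parse-length {k = suc k} {l = suc l} {h = suc h} {w = D ∷ w} (down p) =
  cong suc (trans (+-suc _ h) (trans (cong suc (parse-length p)) (sym (+-suc k l))))
parse-length {k = k} {l = suc l} (flatᴺ p) = trans (cong suc (parse-length p)) (sym (+-suc k l))
parse-length (flatᴱ p) = cong suc (parse-length p)

0∷-linked : {xs : Vec ℕ k} → Linked _≤_ xs → Linked _≤_ (0 ∷ xs)
0∷-linked []        = [-]
0∷-linked [-]       = z≤n ∷ [-]
0∷-linked (x≤ ∷ xs) = z≤n ∷ x≤ ∷ xs

map-suc-linked : {xs : Vec ℕ k} → Linked _≤_ xs → Linked _≤_ (Vec.map suc xs)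
map-suc-linked = Linked.map⁺ ∘ Linked.map s≤s

parse⇒linked : Parse h T B w → Linked _≤_ T × Linked _≤_ B
parse⇒linked stop = [-] , [-]
parse⇒linked (up p) with T≤ , B≤ ← parse⇒linked p = map-suc-linked T≤ , map-suc-linked B≤
parse⇒linked (down p) with T≤ , B≤ ← parse⇒linked p = 0∷-linked T≤ , 0∷-linked B≤
parse⇒linked (flatᴺ p) with T≤ , B≤ ← parse⇒linked p = map-suc-linked T≤ , 0∷-linked B≤
parse⇒linked (flatᴱ p) with T≤ , B≤ ← parse⇒linked p = 0∷-linked T≤ , map-suc-linked B≤

-- Balanced stacks and their parses.

-- At height 0 `clear` says, apart from the position of the last entries, that
-- no initial segments of the two stacks form a forbidden subconfiguration.
record Balanced {k l} (h : ℕ) (T : Vec ℕ (suc k)) (B : Vec ℕ (suc l)) : Set where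
  field
    lastᵀ : h + lookup T (fromℕ k) ≡ l
    lastᴮ : h + lookup B (fromℕ l) ≡ k
    clear : ∀ i j → toℕ i + toℕ j < k + l →
            toℕ j < h + lookup T i ⊎ toℕ i < h + lookup B j

open Balanced

lookup-map-suc : ∀ h (xs : Vec ℕ k) i → h + lookup (Vec.map suc xs) i ≡ suc h + lookup xs i
lookup-map-suc h xs i = trans (cong (h +_) (Vec.lookup-map i suc xs)) (+-suc h (lookup xs i))

-- Entries occur in `Balanced` only in the form h + entry, so raising all of them cancels lowering
-- the height.
up-balanced : {T : Vec ℕ (suc k)} {B : Vec ℕ (suc l)} →
              Balanced (suc h) T B → Balanced h (Vec.map suc T) (Vec.map suc B)
up-balanced {h = h} {T = T} {B} p = record
  { lastᵀ = trans (lookup-map-suc h T _) (lastᵀ p)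
  ; lastᴮ = trans (lookup-map-suc h B _) (lastᴮ p)
  ; clear = λ i j <kl → Sum.map (subst (toℕ j <_) (sym (lookup-map-suc h T i)))
                                (subst (toℕ i <_) (sym (lookup-map-suc h B j))) (clear p i j <kl)
  }

up-balanced⁻¹ : {T : Vec ℕ (suc k)} {B : Vec ℕ (suc l)} →
                Balanced h (Vec.map suc T) (Vec.map suc B) → Balanced (suc h) T B
up-balanced⁻¹ {h = h} {T = T} {B} p = record
  { lastᵀ = trans (sym (lookup-map-suc h T _)) (lastᵀ p)
  ; lastᴮ = trans (sym (lookup-map-suc h B _)) (lastᴮ p)
  ; clear = λ i j <kl → Sum.map (subst (toℕ j <_) (lookup-map-suc h T i))
                                (subst (toℕ i <_) (lookup-map-suc h B j)) (clear p i j <kl)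
  }

-- Pairs containing a new head are clear because the height is positive. For the others both
-- positions and the height shift by one.
down-balanced : {T : Vec ℕ (suc k)} {B : Vec ℕ (suc l)} →
                Balanced h T B → Balanced (suc h) (0 ∷ T) (0 ∷ B)
down-balanced {k} {l} {h} {T} {B} p = record
  { lastᵀ = cong suc (lastᵀ p)
  ; lastᴮ = cong suc (lastᴮ p)
  ; clear = cl
  }
  where
  cl : ∀ i j → toℕ i + toℕ j < suc k + suc l →
       toℕ j < suc h + lookup (0 ∷ T) i ⊎ toℕ i < suc h + lookup (0 ∷ B) j
  cl zero    j       _ = inj₂ z<s
  cl (suc i) zero    _ = inj₁ z<s
  cl (suc i) (suc j) i+j<k+l = Sum.map s<s s<s (clear p i j
    (s<s⁻¹ (s<s⁻¹ (subst₂ _<_ (cong suc (+-suc (toℕ i) (toℕ j))) (cong suc (+-suc k l)) i+j<k+l))))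

down-balanced⁻¹ : {T : Vec ℕ (suc k)} {B : Vec ℕ (suc l)} →
                  Balanced (suc h) (0 ∷ T) (0 ∷ B) → Balanced h T B
down-balanced⁻¹ {k} {l} p = record
  { lastᵀ = suc-injective (lastᵀ p)
  ; lastᴮ = suc-injective (lastᴮ p)
  ; clear = λ i j i+j<k+l → Sum.map s<s⁻¹ s<s⁻¹ (clear p (suc i) (suc j)
      (subst₂ _<_ (sym (cong suc (+-suc (toℕ i) (toℕ j)))) (sym (cong suc (+-suc k l))) (s<s (s<s i+j<k+l))))
  }

-- Pairs containing the new head of T are clear because every entry of B has become positive. For
-- the others the shift of the position in T matches the increase in B.
flatᴱ-balanced : {T : Vec ℕ (suc k)} {B : Vec ℕ (suc l)} →
                 Balanced h T B → Balanced h (0 ∷ T) (Vec.map suc B)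
flatᴱ-balanced {k} {l} {h} {T} {B} p = record
  { lastᵀ = lastᵀ p
  ; lastᴮ = trans (lookup-map-suc h B _) (cong suc (lastᴮ p))
  ; clear = cl
  }
  where
  cl : ∀ i j → toℕ i + toℕ j < suc k + l →
       toℕ j < h + lookup (0 ∷ T) i ⊎ toℕ i < h + lookup (Vec.map suc B) j
  cl i j i+j<k+l rewrite lookup-map-suc h B j with i
  ... | zero   = inj₂ z<s
  ... | suc i′ = Sum.map id s<s (clear p i′ j (s<s⁻¹ i+j<k+l))

flatᴱ-balanced⁻¹ : {T : Vec ℕ (suc k)} {B : Vec ℕ (suc l)} →
                   Balanced h (0 ∷ T) (Vec.map suc B) → Balanced h T B
flatᴱ-balanced⁻¹ {h = h} {T = T} {B} p = record
  { lastᵀ = lastᵀ p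
  ; lastᴮ = suc-injective (trans (sym (lookup-map-suc h B _)) (lastᴮ p))
  ; clear = λ i j <kl → Sum.map id (λ lt → s<s⁻¹ (subst (toℕ (suc i) <_) (lookup-map-suc h B j) lt))
                          (clear p (suc i) j (s<s <kl))
  }

balanced-sym : {T : Vec ℕ (suc k)} {B : Vec ℕ (suc l)} → Balanced h T B → Balanced h B T
balanced-sym {k} {l} p = record
  { lastᵀ = lastᴮ p
  ; lastᴮ = lastᵀ p
  ; clear = λ i j <kl → Sum.swap (clear p j i (subst₂ _<_ (+-comm (toℕ i) (toℕ j)) (+-comm l k) <kl))
  }

parse⇒balanced : Parse h T B w → Balanced h T B
parse⇒balanced stop = record
  -- The only pair here is that of the last entries, where by `lastᵀ` and `lastᴮ` the condition
  -- would read l < l or k < k; the bound on `toℕ i + toℕ j` excludes exactly this pair.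
  { lastᵀ = refl ; lastᴮ = refl ; clear = λ { zero zero () } }
parse⇒balanced (up p)    = up-balanced (parse⇒balanced p)
parse⇒balanced (down p)  = down-balanced (parse⇒balanced p)
parse⇒balanced (flatᴺ p) =
  balanced-sym (flatᴱ-balanced (balanced-sym (parse⇒balanced p)))
parse⇒balanced (flatᴱ p) = flatᴱ-balanced (parse⇒balanced p)

map-suc-pred : ∀ {x} {xs : Vec ℕ k} → Linked _≤_ (suc x ∷ xs) → Vec.map suc (Vec.map pred xs) ≡ xs
map-suc-pred [-] = refl
map-suc-pred {xs = suc y ∷ ys} (_ ∷ ys≤) = cong (suc y ∷_) (map-suc-pred ys≤)

map-pred-linked : {xs : Vec ℕ k} → Linked _≤_ xs → Linked _≤_ (Vec.map pred xs)
map-pred-linked = Linked.map⁺ ∘ Linked.map pred-mono-≤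

last≢0 : ∀ {x} {xs : Vec ℕ k} → Linked _≤_ (suc x ∷ xs) →
         ¬ h + lookup (suc x ∷ xs) (fromℕ k) ≡ 0
last≢0 {k} {h} x≤ eq with () ← subst (_ ≤_) (m+n≡0⇒n≡0 h eq)
  (All.lookup⁺ (Linked.Linked⇒All ≤-trans ≤-refl x≤) (fromℕ k))

-- This runs the algorithm; `lastᵀ` and `lastᴮ` exclude that one stack is used up before the other,
-- and `clear` excludes that the path goes below height 0.
balanced⇒parse : ∀ {k l} t (T : Vec ℕ k) b (B : Vec ℕ l) →
                 Linked _≤_ (t ∷ T) → Linked _≤_ (b ∷ B) →
                 Balanced h (t ∷ T) (b ∷ B) → ∃[ w ] Parse h (t ∷ T) (b ∷ B) w
balanced⇒parse {h} (suc t) T (suc b) B T≤ B≤ p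
  with w , q ← balanced⇒parse t (Vec.map pred T) b (Vec.map pred B)
         (map-pred-linked T≤) (map-pred-linked B≤)
         (up-balanced⁻¹ (subst₂ (λ T B → Balanced h (suc t ∷ T) (suc b ∷ B))
           (sym (map-suc-pred T≤)) (sym (map-suc-pred B≤)) p))
  = U ∷ w , subst₂ (λ T B → Parse h (suc t ∷ T) (suc b ∷ B) (U ∷ w))
              (map-suc-pred T≤) (map-suc-pred B≤) (up q)
balanced⇒parse zero [] (suc b) B T≤ B≤ p = contradiction (lastᴮ p) (last≢0 B≤)
balanced⇒parse {h} zero (t ∷ T) (suc b) B T≤ B≤ p
  with w , q ← balanced⇒parse t T b (Vec.map pred B) (Linked.tail T≤) (map-pred-linked B≤)
         (flatᴱ-balanced⁻¹ (subst (λ B → Balanced h (0 ∷ t ∷ T) (suc b ∷ B)) (sym (map-suc-pred B≤)) p))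
  = Hᴱ ∷ w , subst (λ B → Parse h (0 ∷ t ∷ T) (suc b ∷ B) (Hᴱ ∷ w)) (map-suc-pred B≤) (flatᴱ q)
balanced⇒parse (suc t) T zero [] T≤ B≤ p = contradiction (lastᵀ p) (last≢0 T≤)
balanced⇒parse {h} (suc t) T zero (b ∷ B) T≤ B≤ p
  with w , q ← balanced⇒parse t (Vec.map pred T) b B (map-pred-linked T≤) (Linked.tail B≤)
         (balanced-sym (flatᴱ-balanced⁻¹ (balanced-sym
           (subst (λ T → Balanced h (suc t ∷ T) (0 ∷ b ∷ B)) (sym (map-suc-pred T≤)) p))))
  = Hᴺ ∷ w , subst (λ T → Parse h (suc t ∷ T) (0 ∷ b ∷ B) (Hᴺ ∷ w)) (map-suc-pred T≤) (flatᴺ q)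
balanced⇒parse zero [] zero [] T≤ B≤ p with refl ← trans (sym (+-identityʳ _)) (lastᵀ p) = [] , stop
balanced⇒parse {suc h} zero (t ∷ T) zero (b ∷ B) T≤ B≤ p
  with w , q ← balanced⇒parse t T b B (Linked.tail T≤) (Linked.tail B≤) (down-balanced⁻¹ p)
  = D ∷ w , down q
balanced⇒parse {zero} zero (t ∷ T) zero (b ∷ B) T≤ B≤ p
  -- A `D` at height 0 would require two heads 0, for which `clear` reads 0 < 0.
  with clear p zero zero z<s
... | inj₁ ()
... | inj₂ ()
balanced⇒parse {zero} zero [] zero (b ∷ B) T≤ B≤ p with () ← lastᵀ p
balanced⇒parse {suc h} zero [] zero (b ∷ B) T≤ B≤ p with () ← lastᴮ p
balanced⇒parse {zero} zero (t ∷ T) zero [] T≤ B≤ p with () ← lastᴮ p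
balanced⇒parse {suc h} zero (t ∷ T) zero [] T≤ B≤ p with () ← lastᵀ p

-- Boundary paths and polyominoes.

upper lower : Step → Dir
upper U  = N
upper D  = E
upper Hᴺ = N
upper Hᴱ = E
lower U  = E
lower D  = N
lower Hᴺ = N
lower Hᴱ = E

combine-upper-lower : ∀ s → combine (upper s) (lower s) ≡ s
combine-upper-lower U  = refl
combine-upper-lower D  = refl
combine-upper-lower Hᴺ = refl
combine-upper-lower Hᴱ = refl

zipWith-combine : ∀ w → List.zipWith combine (List.map upper w) (List.map lower w) ≡ w
zipWith-combine []      = refl
zipWith-combine (s ∷ w) = cong₂ _∷_ (combine-upper-lower s) (zipWith-combine w)

stairs-map-suc : ∀ a b e x (hs : Vec ℕ k) →
                 stairs a b (suc e) (suc x) (Vec.map suc hs) ≡ stairs a b e x hs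
stairs-map-suc a b e x []       = refl
stairs-map-suc a b e x (h ∷ hs) =
  cong (λ p → List.replicate (h ∸ x) a ++ b ∷ p) (stairs-map-suc a b e h hs)

stairs-suc : ∀ a b e (hs : Vec ℕ (suc k)) →
             stairs a b (suc e) 0 (Vec.map suc hs) ≡ a ∷ stairs a b e 0 hs
stairs-suc a b e (h ∷ hs) =
  cong (λ p → a ∷ List.replicate h a ++ b ∷ p) (stairs-map-suc a b e h hs)

-- The boundary path without its first step. It ends at the last entry, so its last step has
-- direction b.
path : ∀ {k} → Dir → Dir → Vec ℕ (suc k) → List Dir
path {k} a b hs = stairs a b (lookup hs (fromℕ k)) 0 hs

path-map-suc : ∀ a b (hs : Vec ℕ (suc k)) → path a b (Vec.map suc hs) ≡ a ∷ path a b hs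
path-map-suc {k} a b hs =
  trans (cong (λ e → stairs a b e 0 (Vec.map suc hs)) (Vec.lookup-map (fromℕ k) suc hs))
        (stairs-suc a b (lookup hs (fromℕ k)) hs)

-- Raising all entries of a stack prepends a step in direction a to its path, and a new head 0
-- prepends one in direction b. Each constructor therefore prepends the directions encoded by its
-- step.
parse⇒paths : Parse h T B w →
              path N E T ≡ List.map upper w ∷ʳ E × path E N B ≡ List.map lower w ∷ʳ N
parse⇒paths stop = refl , refl
parse⇒paths (up {T = T} {B = B} p) with p₁ , p₂ ← parse⇒paths p =
  trans (path-map-suc N E T) (cong (N ∷_) p₁) , trans (path-map-suc E N B) (cong (E ∷_) p₂)
parse⇒paths (down p) with p₁ , p₂ ← parse⇒paths p =
  cong (E ∷_) p₁ , cong (N ∷_) p₂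
parse⇒paths (flatᴺ {T = T} p) with p₁ , p₂ ← parse⇒paths p =
  trans (path-map-suc N E T) (cong (N ∷_) p₁) , cong (N ∷_) p₂
parse⇒paths (flatᴱ {B = B} p) with p₁ , p₂ ← parse⇒paths p =
  cong (E ∷_) p₁ , trans (path-map-suc E N B) (cong (E ∷_) p₂)

-- At height h the upper path is already h above the lower one, and the lower one h further to the
-- right; each has that many fewer steps left in this direction.
parse⇒ends : {T : Vec ℕ (suc k)} {B : Vec ℕ (suc l)} → Parse h T B w →
             (proj₁ (end (List.map upper w)) ≡ k × h + proj₂ (end (List.map upper w)) ≡ l) ×
             (h + proj₁ (end (List.map lower w)) ≡ k × proj₂ (end (List.map lower w)) ≡ l)
parse⇒ends stop = (refl , refl) , refl , refl
parse⇒ends {h = h} (up p) with (a , b) , c , d ← parse⇒ends p =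
  (a , trans (+-suc h _) b) , trans (+-suc h _) c , d
parse⇒ends (down p) with (a , b) , c , d ← parse⇒ends p =
  (cong suc a , cong suc b) , cong suc c , cong suc d
parse⇒ends {h = h} (flatᴺ p) with (a , b) , c , d ← parse⇒ends p =
  (a , trans (+-suc h _) (cong suc b)) , c , cong suc d
parse⇒ends {h = h} (flatᴱ p) with (a , b) , c , d ← parse⇒ends p =
  (cong suc a , b) , trans (+-suc h _) (cong suc c) , d

end-∷ʳᴱ : ∀ p → end (p ∷ʳ E) ≡ (suc (proj₁ (end p)) , proj₂ (end p))
end-∷ʳᴱ []      = refl
end-∷ʳᴱ (N ∷ p) rewrite end-∷ʳᴱ p = refl
end-∷ʳᴱ (E ∷ p) rewrite end-∷ʳᴱ p = refl

end-∷ʳᴺ : ∀ p → end (p ∷ʳ N) ≡ (proj₁ (end p) , suc (proj₂ (end p)))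
end-∷ʳᴺ []      = refl
end-∷ʳᴺ (N ∷ p) rewrite end-∷ʳᴺ p = refl
end-∷ʳᴺ (E ∷ p) rewrite end-∷ʳᴺ p = refl

end-size : ∀ p → proj₁ (end p) + proj₂ (end p) ≡ List.length p
end-size []      = refl
end-size (N ∷ p) = trans (+-suc (proj₁ (end p)) _) (cong suc (end-size p))
end-size (E ∷ p) = cong suc (end-size p)

end-take-mono : ∀ p {i j} → i ≤ j → proj₁ (end (List.take i p)) ≤ proj₁ (end (List.take j p))
end-take-mono p       z≤n       = z≤n
end-take-mono []      (s≤s i≤j) = z≤n
end-take-mono (N ∷ p) (s≤s i≤j) = end-take-mono p i≤j
end-take-mono (E ∷ p) (s≤s i≤j) = s≤s (end-take-mono p i≤j)

upperPath lowerPath : List Step → List Dir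
upperPath w = N ∷ List.map upper w ∷ʳ E
lowerPath w = E ∷ List.map lower w ∷ʳ N

-- The horizontal distance between the i-th points of the two inner paths is
-- the height of the Motzkin path, and the first steps of the outer paths add 1.
motzkin⇒left : MotzkinFrom h w → ∀ i →
  proj₁ (end (List.take i (List.map upper w ∷ʳ E))) <
    suc (h + proj₁ (end (List.take i (List.map lower w ∷ʳ N)))) ⊎
  List.length w < i
motzkin⇒left p         zero    = inj₁ z<s
motzkin⇒left []        (suc i) = inj₂ z<s
motzkin⇒left {h} (up p)    (suc i) =
  Sum.map (λ lt → <-≤-trans lt (≤-reflexive (cong suc (sym (+-suc h _))))) s<s (motzkin⇒left p i)
motzkin⇒left (down p)  (suc i) = Sum.map s<s s<s (motzkin⇒left p i)
motzkin⇒left (flatᴺ p) (suc i) = Sum.map id s<s (motzkin⇒left p i)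
motzkin⇒left {h} (flatᴱ p) (suc i) =
  Sum.map (λ lt → <-≤-trans (s<s lt) (≤-reflexive (cong suc (sym (+-suc h _))))) s<s (motzkin⇒left p i)

length-map-∷ʳ : ∀ {A B : Set} (f : A → B) xs y → List.length (List.map f xs ∷ʳ y) ≡ suc (List.length xs)
length-map-∷ʳ f xs y = trans (List.length-++-sucʳ (List.map f xs) y [])
  (cong suc (trans (cong List.length (List.++-identityʳ (List.map f xs))) (List.length-map f xs)))

data Position (w : List Step) (i : ℕ) : Set where
  start    : i ≡ 0 → Position w i
  interior : i < 2 + List.length w →
             proj₁ (end (List.take i (upperPath w))) < proj₁ (end (List.take i (lowerPath w))) →
             Position w i
  finish   : 2 + List.length w ≤ i → Position w i

position : MotzkinFrom 0 w → ∀ i → Position w i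
position p zero = start refl
position {w} p (suc i) with motzkin⇒left p i | i ≤? List.length w
... | inj₂ w<i | _       = finish (s<s w<i)
... | inj₁ _   | no i≰w  = finish (s<s (≰⇒> i≰w))
... | inj₁ u<l | yes i≤w = interior (s<s (s≤s i≤w)) u<l

-- The coordinates of a point sum to its step number. Hence common points have equal step numbers,
-- and on a vertical line a later point is higher; `position` compares the paths after equally many
-- steps.
polyomino : MotzkinFrom 0 w → end (upperPath w) ≡ (suc m , n) → end (lowerPath w) ≡ (suc m , n) →
            IsPolyomino m n (upperPath w , lowerPath w)
polyomino {w = w} {m} {n} p uEnd lEnd = record
  { upper-end = uEnd
  ; lower-end = lEnd
  ; above     = λ { (i , u) (j , l) → above i j u l }
  ; meet      = λ { (i , u) (j , l) → meet i j u l }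
  }
  where
  size : ℕ
  size = 2 + List.length w

  uSize : List.length (upperPath w) ≡ size
  uSize = cong suc (length-map-∷ʳ upper w E)

  lSize : List.length (lowerPath w) ≡ size
  lSize = cong suc (length-map-∷ʳ lower w N)

  prefix : ∀ {x y i} q → List.length q ≡ size → (x , y) ≡ end (List.take i q) → x + y ≡ i ⊓ size
  prefix {i = i} q eq refl = trans (end-size (List.take i q))
    (trans (List.length-take i q) (cong (i ⊓_) eq))

  whole : ∀ {i} q → List.length q ≡ size → size ≤ i → end (List.take i q) ≡ end q
  whole {i} q eq ≤i = cong end (List.take-all i q (≤-trans (≤-reflexive eq) ≤i))

  starts : ∀ j → proj₁ (end (List.take j (lowerPath w))) ≡ 0 → ¬ 0 < j
  starts zero _ ()

  above : ∀ {x y y′} i j → (x , y) ≡ end (List.take i (upperPath w)) →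
          (x , y′) ≡ end (List.take j (lowerPath w)) → y′ ≤ y
  above {x} {y} {y′} i j u l with j ≤? i
  ... | yes j≤i = +-cancelˡ-≤ x y′ y (begin
    x + y′    ≡⟨ prefix (lowerPath w) lSize l ⟩
    j ⊓ size  ≤⟨ ⊓-monoˡ-≤ size j≤i ⟩
    i ⊓ size  ≡⟨ prefix (upperPath w) uSize u ⟨
    x + y     ∎)
    where open ≤-Reasoning
  ... | no j≰i with position p i
  -- The lower path begins with `E`, so it leaves x = 0 at once.
  ...   | start refl = contradiction (≰⇒> j≰i) (starts j (trans (cong proj₁ (sym l)) (cong proj₁ u)))
  ...   | interior _ u<l = contradiction u<l (≤⇒≯ (begin
    proj₁ (end (List.take i (lowerPath w)))  ≤⟨ end-take-mono (lowerPath w) (≰⇒≥ j≰i) ⟩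
    proj₁ (end (List.take j (lowerPath w)))  ≡⟨ cong proj₁ l ⟨
    x                                        ≡⟨ cong proj₁ u ⟩
    proj₁ (end (List.take i (upperPath w)))  ∎))
    where open ≤-Reasoning
  ...   | finish ≤i = ≤-reflexive (cong proj₂ (trans l
    (trans (whole (lowerPath w) lSize (≤-trans ≤i (≰⇒≥ j≰i))) (trans lEnd
      (sym (trans u (trans (whole (upperPath w) uSize ≤i) uEnd)))))))

  meet : ∀ {x} i j → x ≡ end (List.take i (upperPath w)) → x ≡ end (List.take j (lowerPath w)) →
         x ≡ (0 , 0) ⊎ x ≡ (suc m , n)
  meet {x} i j u l with position p i
  ... | start refl = inj₁ u
  ... | finish ≤i  = inj₂ (trans u (trans (whole (upperPath w) uSize ≤i) uEnd))
  ... | interior i< u<l with i ≤? j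
  ...   | yes i≤j = contradiction u<l (≤⇒≯ (begin
    proj₁ (end (List.take i (lowerPath w)))  ≤⟨ end-take-mono (lowerPath w) i≤j ⟩
    proj₁ (end (List.take j (lowerPath w)))  ≡⟨ cong proj₁ l ⟨
    proj₁ x                                  ≡⟨ cong proj₁ u ⟩
    proj₁ (end (List.take i (upperPath w)))  ∎))
    where open ≤-Reasoning
  ...   | no i≰j = contradiction (≰⇒> i≰j) (≤⇒≯ (≤-reflexive (begin
    i         ≡⟨ m≤n⇒m⊓n≡m (<⇒≤ i<) ⟨
    i ⊓ size  ≡⟨ prefix (upperPath w) uSize u ⟨
    proj₁ x + proj₂ x  ≡⟨ prefix (lowerPath w) lSize l ⟩
    j ⊓ size  ≡⟨ m≤n⇒m⊓n≡m (<⇒≤ (<-trans (≰⇒> i≰j) i<)) ⟩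
    j         ∎)))
    where open ≡-Reasoning

-- Area and level.

twiceArea : ℤ → List Step → ℤ
twiceArea h []      = ℤ.0ℤ
twiceArea h (s ∷ w) = (h ℤ.+ (h ℤ.+ rise s)) ℤ.+ twiceArea (h ℤ.+ rise s) w

halves : ∀ a b → (a / 2) ℚ.+ (b / 2) ≃ (a ℤ.+ b) / 2
halves a b = *≡* (eq a b)
  where
  eq = solve 2 (λ a b →
    (a :* con (ℤ.+ 2) :+ b :* con (ℤ.+ 2)) :* con (ℤ.+ 2) :=
    (a :+ b) :* con (ℤ.+ 4)) refl

-- Doubling moves the recursion into the integers, where the ring solver applies.
areaFrom-twiceArea : ∀ h w → areaFrom h w ≃ twiceArea h w / 2
areaFrom-twiceArea h []      = *≡* refl
areaFrom-twiceArea h (s ∷ w) = ℚ.≃-trans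
  (ℚ.+-congʳ ((h ℤ.+ (h ℤ.+ rise s)) / 2) (areaFrom-twiceArea (h ℤ.+ rise s) w))
  (halves (h ℤ.+ (h ℤ.+ rise s)) (twiceArea (h ℤ.+ rise s) w))

-- Twice the area, for k + 1 top entries (with the sentinel) and l + 1 bottom
-- entries of total s. The terms in h are forced by the recursion for the area.
doubledLevel : ℤ → ℤ → ℤ → ℤ → ℤ
doubledLevel h k l s =
  ℤ.+ 2 ℤ.* s ℤ.+ ℤ.+ 2 ℤ.- ℤ.+ 2 ℤ.* ((ℤ.1ℤ ℤ.+ k) ℤ.* (ℤ.1ℤ ℤ.+ l))
    ℤ.+ ℤ.+ 2 ℤ.* (h ℤ.* (k ℤ.+ l)) ℤ.+ ℤ.+ 4 ℤ.* h ℤ.- h ℤ.* h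

doubledLevelᴾ : (h k l s : Polynomial n) → Polynomial n
doubledLevelᴾ h k l s =
  con (ℤ.+ 2) :* s :+ con (ℤ.+ 2) :- con (ℤ.+ 2) :* ((con ℤ.1ℤ :+ k) :* (con ℤ.1ℤ :+ l))
    :+ con (ℤ.+ 2) :* (h :* (k :+ l)) :+ con (ℤ.+ 4) :* h :- h :* h

sum-map-suc : (xs : Vec ℕ k) → Vec.sum (Vec.map suc xs) ≡ k + Vec.sum xs
sum-map-suc []       = refl
sum-map-suc {suc k} (x ∷ xs) = cong suc (trans (cong (x +_) (sum-map-suc xs)) (eq x k (Vec.sum xs)))
  where
  eq : ∀ x k s → x + (k + s) ≡ k + (x + s)
  eq = solve-∀

flat-area : ∀ h w → (h ℤ.+ (h ℤ.+ ℤ.0ℤ)) ℤ.+ twiceArea (h ℤ.+ ℤ.0ℤ) w ≡ h ℤ.+ h ℤ.+ twiceArea h w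
flat-area h w = cong (λ h′ → (h ℤ.+ h′) ℤ.+ twiceArea h′ w) (ℤ.+-identityʳ h)

-- Raising a stack adds its number of entries to its sum; with this, each constructor leaves a
-- polynomial identity.
parse⇒twiceArea : {T : Vec ℕ (suc k)} {B : Vec ℕ (suc l)} → Parse h T B w →
  twiceArea (ℤ.+ h) w ≡ doubledLevel (ℤ.+ h) (ℤ.+ k) (ℤ.+ l) (ℤ.+ (Vec.sum T + Vec.sum B))
parse⇒twiceArea stop = refl
parse⇒twiceArea {k} {l} {h} (up {T = T} {B = B} p)
  rewrite sum-map-suc T | sum-map-suc B | +-comm h 1 | parse⇒twiceArea p
  = eq (ℤ.+ h) (ℤ.+ k) (ℤ.+ l) (ℤ.+ Vec.sum T) (ℤ.+ Vec.sum B)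
  where
  eq = solve 5 (λ h k l s t →
    (h :+ (con ℤ.1ℤ :+ h)) :+ doubledLevelᴾ (con ℤ.1ℤ :+ h) k l (s :+ t) :=
    doubledLevelᴾ h k l ((con ℤ.1ℤ :+ k :+ s) :+ (con ℤ.1ℤ :+ l :+ t))) refl
parse⇒twiceArea {suc k} {suc l} {suc h} (down {T = T} {B = B} p)
  rewrite parse⇒twiceArea p
  = eq (ℤ.+ h) (ℤ.+ k) (ℤ.+ l) (ℤ.+ Vec.sum T) (ℤ.+ Vec.sum B)
  where
  eq = solve 5 (λ h k l s t →
    (con ℤ.1ℤ :+ h :+ h) :+ doubledLevelᴾ h k l (s :+ t) :=
    doubledLevelᴾ (con ℤ.1ℤ :+ h) (con ℤ.1ℤ :+ k) (con ℤ.1ℤ :+ l) (s :+ t)) refl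
parse⇒twiceArea {k} {suc l} {h} {Hᴺ ∷ w} (flatᴺ {T = T} {B = B} p)
  rewrite sum-map-suc T
  = trans (flat-area (ℤ.+ h) w) (trans (cong (λ a → ℤ.+ (h + h) ℤ.+ a) (parse⇒twiceArea p))
      (eq (ℤ.+ h) (ℤ.+ k) (ℤ.+ l) (ℤ.+ Vec.sum T) (ℤ.+ Vec.sum B)))
  where
  eq = solve 5 (λ h k l s t →
    (h :+ h) :+ doubledLevelᴾ h k l (s :+ t) :=
    doubledLevelᴾ h k (con ℤ.1ℤ :+ l) ((con ℤ.1ℤ :+ k :+ s) :+ t)) refl
parse⇒twiceArea {suc k} {l} {h} {Hᴱ ∷ w} (flatᴱ {T = T} {B = B} p)
  rewrite sum-map-suc B
  = trans (flat-area (ℤ.+ h) w) (trans (cong (λ a → ℤ.+ (h + h) ℤ.+ a) (parse⇒twiceArea p))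
      (eq (ℤ.+ h) (ℤ.+ k) (ℤ.+ l) (ℤ.+ Vec.sum T) (ℤ.+ Vec.sum B)))
  where
  eq = solve 5 (λ h k l s t →
    (h :+ h) :+ doubledLevelᴾ h k l (s :+ t) :=
    doubledLevelᴾ h (con ℤ.1ℤ :+ k) l (s :+ (con ℤ.1ℤ :+ l :+ t))) refl

sum-∷ʳ : ∀ (xs : Vec ℕ k) x → Vec.sum (xs Vec.∷ʳ x) ≡ Vec.sum xs + x
sum-∷ʳ []       x = +-identityʳ x
sum-∷ʳ (y ∷ xs) x = trans (cong (y +_) (sum-∷ʳ xs x)) (sym (+-assoc y (Vec.sum xs) x))

-- At height 0 the sentinel n in the total turns (1 + m)(1 + n) - 1 into m (1 + n), the constant in
-- `level`.
level≃Area : (t : Vec ℕ m) (b : Vec ℕ (suc n)) → Parse 0 (t Vec.∷ʳ n) b w →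
             level (t , b) / 1 ≃ Area w
level≃Area {m} {n} {w = w} t b p =
  ℚ.≃-trans (*≡* eq) (ℚ.≃-sym (areaFrom-twiceArea ℤ.0ℤ w))
  where
  identity = solve 4 (λ m n s r →
    (s :+ r :- m :* (con ℤ.1ℤ :+ n)) :* con (ℤ.+ 2) :=
    doubledLevelᴾ (con ℤ.0ℤ) m n ((s :+ n) :+ r) :* con (ℤ.+ 1)) refl
  eq : level (t , b) ℤ.* ℤ.+ 2 ≡ twiceArea ℤ.0ℤ w ℤ.* ℤ.+ 1
  eq rewrite parse⇒twiceArea p | sum-∷ʳ t n | ℤ.pos-* m (suc n) =
    identity (ℤ.+ m) (ℤ.+ n) (ℤ.+ Vec.sum t) (ℤ.+ Vec.sum b)

-- Vector updates by topplings and single grains.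

_≟ᵛ_ : (v w : Vertex m n) → Dec (v ≡ w)
_≟ᵛ_ = Sum.≡-dec Fin._≟_ Fin._≟_

map-suc-updateAt-∸ : ∀ (xs : Vec ℕ k) i d → d ≤ lookup xs i →
                     updateAt (Vec.map suc xs) i (_∸ d) ≡ Vec.map suc (updateAt xs i (_∸ d))
map-suc-updateAt-∸ xs i d d≤ = sym (Vec.map-updateAt xs i (sym (+-∸-assoc 1 d≤)))

updateAt-suc-∸ : ∀ (xs : Vec ℕ k) i j d → d ≤ lookup xs i →
                 updateAt (updateAt xs j suc) i (_∸ d) ≡ updateAt (updateAt xs i (_∸ d)) j suc
updateAt-suc-∸ (x ∷ xs) zero    zero    d d≤ = cong (_∷ xs) (+-∸-assoc 1 d≤)
updateAt-suc-∸ (x ∷ xs) zero    (suc j) d d≤ = refl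
updateAt-suc-∸ (x ∷ xs) (suc i) zero    d d≤ = refl
updateAt-suc-∸ (x ∷ xs) (suc i) (suc j) d d≤ = cong (x ∷_) (updateAt-suc-∸ xs i j d d≤)

lookup≤lookup-map-suc : ∀ (xs : Vec ℕ k) i → lookup xs i ≤ lookup (Vec.map suc xs) i
lookup≤lookup-map-suc xs i = ≤-trans (n≤1+n _) (≤-reflexive (sym (Vec.lookup-map i suc xs)))

lookup≤lookup-updateAt-suc : ∀ (xs : Vec ℕ k) i j → lookup xs i ≤ lookup (updateAt xs j suc) i
lookup≤lookup-updateAt-suc (x ∷ xs) zero    zero    = n≤1+n x
lookup≤lookup-updateAt-suc (x ∷ xs) zero    (suc j) = ≤-refl
lookup≤lookup-updateAt-suc (x ∷ xs) (suc i) zero    = ≤-refl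
lookup≤lookup-updateAt-suc (x ∷ xs) (suc i) (suc j) = lookup≤lookup-updateAt-suc xs i j

-- The abelian property of topplings

topple-unstable : ∀ (c : Config m n) v w → v ≢ w → Unstable c w → Unstable (topple v c) w
topple-unstable (t , b) (inj₁ i) (inj₁ j) i≢j u =
  ≤-trans u (≤-reflexive (sym (Vec.lookup∘updateAt′ j i (i≢j ∘ cong inj₁ ∘ sym) t)))
topple-unstable (t , b) (inj₁ i) (inj₂ j) _   u = ≤-trans u (lookup≤lookup-map-suc b j)
topple-unstable (t , b) (inj₂ i) (inj₁ j) _   u = ≤-trans u (lookup≤lookup-map-suc t j)
topple-unstable (t , b) (inj₂ i) (inj₂ j) i≢j u =
  ≤-trans u (≤-reflexive (sym (Vec.lookup∘updateAt′ j i (i≢j ∘ cong inj₂ ∘ sym) b)))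

topple-commutes : ∀ (c : Config m n) v w → v ≢ w → Unstable c v → Unstable c w →
                  topple v (topple w c) ≡ topple w (topple v c)
topple-commutes (t , b) (inj₁ i) (inj₁ j) i≢j _ _ =
  cong (_, _) (Vec.updateAt-commutes i j (i≢j ∘ cong inj₁) t)
topple-commutes {m} {n} (t , b) (inj₁ i) (inj₂ j) _ u u′ =
  cong₂ _,_ (map-suc-updateAt-∸ t i n u) (sym (map-suc-updateAt-∸ b j (suc m) u′))
topple-commutes {m} {n} (t , b) (inj₂ i) (inj₁ j) _ u u′ =
  cong₂ _,_ (sym (map-suc-updateAt-∸ t j n u′)) (map-suc-updateAt-∸ b i (suc m) u)
topple-commutes (t , b) (inj₂ i) (inj₂ j) i≢j _ _ =
  cong (_ ,_) (Vec.updateAt-commutes i j (i≢j ∘ cong inj₂) b)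

module _ {m n : ℕ} where

  private variable
    c d s s′ : Config m n

  stable-⟶* : Stable c → c ⟶* d → c ≡ d
  stable-⟶* stable ε                 = refl
  stable-⟶* stable (topples v u ◅ _) = contradiction u (<⇒≱ (stable v))

  -- An unstable vertex v stays unstable until it topples, so v occurs in every stabilising
  -- sequence, and its first toppling can be moved to the front.
  ⟶-stabilises : c ⟶ d → c ⟶* s → Stable s → d ⟶* s
  ⟶-stabilises (topples v u) ε stable = contradiction u (<⇒≱ (stable v))
  ⟶-stabilises {c} {s = s} (topples v u) (topples w u′ ◅ c⟶*s) stable with v ≟ᵛ w
  ... | yes refl = c⟶*s
  ... | no  v≢w  = topples w (topple-unstable c v w v≢w u′) ◅
    subst (_⟶* s) (topple-commutes c v w v≢w u u′)
      (⟶-stabilises (topples v (topple-unstable c w v (v≢w ∘ sym) u)) c⟶*s stable)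

  ⟶*-stabilises : c ⟶* d → c ⟶* s → Stable s → d ⟶* s
  ⟶*-stabilises ε          c⟶*s stable = c⟶*s
  ⟶*-stabilises (c⟶e ◅ e⟶*d) c⟶*s stable =
    ⟶*-stabilises e⟶*d (⟶-stabilises c⟶e c⟶*s stable) stable

  stabilisation-unique : c ⟶* s → Stable s → c ⟶* s′ → Stable s′ → s ≡ s′
  stabilisation-unique c⟶*s stable c⟶*s′ stable′ =
    stable-⟶* stable (⟶*-stabilises c⟶*s c⟶*s′ stable′)

  addGrain-grains : ∀ v (c : Config m n) w → grains c w ≤ grains (addGrain v c) w
  addGrain-grains (inj₁ i) (t , b) (inj₁ j) = lookup≤lookup-updateAt-suc t j i
  addGrain-grains (inj₁ i) (t , b) (inj₂ j) = ≤-refl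
  addGrain-grains (inj₂ i) (t , b) (inj₁ j) = ≤-refl
  addGrain-grains (inj₂ i) (t , b) (inj₂ j) = lookup≤lookup-updateAt-suc b j i

  topple-addGrain : ∀ v w (c : Config m n) → Unstable c v →
                    topple v (addGrain w c) ≡ addGrain w (topple v c)
  topple-addGrain (inj₁ i) (inj₁ j) (t , b) u = cong (_, _) (updateAt-suc-∸ t i j n u)
  topple-addGrain (inj₁ i) (inj₂ j) (t , b) u = cong (_ ,_) (Vec.map-updateAt b j refl)
  topple-addGrain (inj₂ i) (inj₁ j) (t , b) u = cong (_, _) (Vec.map-updateAt t j refl)
  topple-addGrain (inj₂ i) (inj₂ j) (t , b) u = cong (_ ,_) (updateAt-suc-∸ b i j (suc m) u)

  addGrain-⟶ : ∀ w → c ⟶ d → addGrain w c ⟶ addGrain w d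
  addGrain-⟶ {c} w (topples v u) = subst (addGrain w c ⟶_) (topple-addGrain v w c u)
    (topples v (≤-trans u (addGrain-grains w c v)))

  -- The sink is a top vertex, so firing it gives one grain to each bottom vertex.
  fireSink : Config m n → Config m n
  fireSink (t , b) = t , Vec.map suc b

  fireSink-⟶ : c ⟶ d → fireSink c ⟶ fireSink d
  fireSink-⟶ {t , b} (topples (inj₁ i) u) = topples (inj₁ i) u
  fireSink-⟶ {t , b} (topples (inj₂ j) u) =
    subst (fireSink (t , b) ⟶_) (cong (_ ,_) (map-suc-updateAt-∸ b j (suc m) u))
      (topples (inj₂ j) (≤-trans u (lookup≤lookup-map-suc b j)))

  infix 4 _≤ᶜ_
  _≤ᶜ_ : Config m n → Config m n → Set
  c ≤ᶜ d = ∀ v → grains c v ≤ grains d v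

  total : Config m n → ℕ
  total (t , b) = Vec.sum t + Vec.sum b

-- Totals and the order on configurations.

sum-updateAt-suc : ∀ (xs : Vec ℕ k) i → Vec.sum (updateAt xs i suc) ≡ suc (Vec.sum xs)
sum-updateAt-suc (x ∷ xs) zero    = refl
sum-updateAt-suc (x ∷ xs) (suc i) = trans (cong (x +_) (sum-updateAt-suc xs i)) (+-suc x _)

sum-mono : ∀ (xs ys : Vec ℕ k) → (∀ i → lookup xs i ≤ lookup ys i) → Vec.sum xs ≤ Vec.sum ys
sum-mono []       []       xs≤ys = z≤n
sum-mono (x ∷ xs) (y ∷ ys) xs≤ys = +-mono-≤ (xs≤ys zero) (sum-mono xs ys (xs≤ys ∘ suc))

total-addGrain : ∀ v (c : Config m n) → total (addGrain v c) ≡ suc (total c)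
total-addGrain (inj₁ i) (t , b) = cong (_+ _) (sum-updateAt-suc t i)
total-addGrain (inj₂ j) (t , b) =
  trans (cong (Vec.sum t +_) (sum-updateAt-suc b j)) (+-suc (Vec.sum t) _)

total-mono : ∀ (c d : Config m n) → c ≤ᶜ d → total c ≤ total d
total-mono (t , b) (t′ , b′) c≤d = +-mono-≤ (sum-mono t t′ (c≤d ∘ inj₁)) (sum-mono b b′ (c≤d ∘ inj₂))

climbᵛ : ∀ (xs ys : Vec ℕ k) → (∀ i → lookup xs i ≤ lookup ys i) →
         xs ≡ ys ⊎ ∃[ i ] (∀ j → lookup (updateAt xs i suc) j ≤ lookup ys j)
climbᵛ []       []       _     = inj₁ refl
climbᵛ (x ∷ xs) (y ∷ ys) xs≤ys with m≤n⇒m<n∨m≡n (xs≤ys zero)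
... | inj₁ x<y  = inj₂ (zero , λ { zero → x<y ; (suc j) → xs≤ys (suc j) })
... | inj₂ refl with climbᵛ xs ys (xs≤ys ∘ suc)
...   | inj₁ refl    = inj₁ refl
...   | inj₂ (i , p) = inj₂ (suc i , λ { zero → ≤-refl ; (suc j) → p j })

-- Allows a larger configuration to be reached grain by grain, with `climb-total` bounding the
-- number of grains.
climb : ∀ (c d : Config m n) → c ≤ᶜ d → c ≡ d ⊎ ∃[ v ] addGrain v c ≤ᶜ d
climb (t , b) (t′ , b′) c≤d with climbᵛ t t′ (c≤d ∘ inj₁) | climbᵛ b b′ (c≤d ∘ inj₂)
... | inj₁ refl    | inj₁ refl    = inj₁ refl
... | inj₂ (i , p) | _            = inj₂ (inj₁ i , λ { (inj₁ j) → p j ; (inj₂ j) → c≤d (inj₂ j) })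
... | inj₁ refl    | inj₂ (i , p) = inj₂ (inj₂ i , λ { (inj₁ j) → ≤-refl ; (inj₂ j) → p j })

climb-total : ∀ v (c d : Config m n) → addGrain v c ≤ᶜ d → total c < total d
climb-total v c d c≤d = subst (_≤ total d) (total-addGrain v c) (total-mono (addGrain v c) d c≤d)

-- Burning

-- The entries xs after r grains have been added to each of them and those from
-- position a onwards have lost deg grains.
fired : ℕ → ℕ → ℕ → Vec ℕ k → Vec ℕ k
fired deg r a       []       = []
fired deg r zero    (x ∷ xs) = (x + r ∸ deg) ∷ fired deg r zero xs
fired deg r (suc a) (x ∷ xs) = (x + r) ∷ fired deg r a xs

fired-none : ∀ deg (xs : Vec ℕ k) → fired deg 0 k xs ≡ xs
fired-none deg []       = refl
fired-none deg (x ∷ xs) = cong₂ _∷_ (+-identityʳ x) (fired-none deg xs)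

fired-add : ∀ deg r (xs : Vec ℕ k) → fired deg r k xs ≡ Vec.map (_+ r) xs
fired-add deg r []       = refl
fired-add deg r (x ∷ xs) = cong (x + r ∷_) (fired-add deg r xs)

fired-all : ∀ deg r (xs : Vec ℕ k) → fired deg r 0 xs ≡ Vec.map (λ x → x + r ∸ deg) xs
fired-all deg r []       = refl
fired-all deg r (x ∷ xs) = cong (x + r ∸ deg ∷_) (fired-all deg r xs)

-- The hypothesis keeps the truncated subtraction exact at the fired positions.
map-suc-fired : ∀ deg r a (xs : Vec ℕ k) → (∀ i → a ≤ toℕ i → deg ≤ lookup xs i + r) →
                Vec.map suc (fired deg r a xs) ≡ fired deg (suc r) a xs
map-suc-fired deg r a       []       p = refl
map-suc-fired deg r zero    (x ∷ xs) p = cong₂ _∷_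
  (trans (sym (+-∸-assoc 1 (p zero z≤n))) (cong (_∸ deg) (sym (+-suc x r))))
  (map-suc-fired deg r zero xs (λ i _ → p (suc i) z≤n))
map-suc-fired deg r (suc a) (x ∷ xs) p = cong₂ _∷_ (sym (+-suc x r))
  (map-suc-fired deg r a xs (λ i a≤i → p (suc i) (s≤s a≤i)))

lookup-fired : ∀ deg r (xs : Vec ℕ k) i → lookup (fired deg r (suc (toℕ i)) xs) i ≡ lookup xs i + r
lookup-fired deg r (x ∷ xs) zero    = refl
lookup-fired deg r (x ∷ xs) (suc i) = lookup-fired deg r xs i

updateAt-fired : ∀ deg r (xs : Vec ℕ k) i →
                 updateAt (fired deg r (suc (toℕ i)) xs) i (_∸ deg) ≡ fired deg r (toℕ i) xs
updateAt-fired deg r (x ∷ xs) zero    = refl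
updateAt-fired deg r (x ∷ xs) (suc i) = cong (x + r ∷_) (updateAt-fired deg r xs i)

index : ∀ r {k i} → r + suc i ≡ k → Σ[ f ∈ Fin k ] toℕ f ≡ i
index r {i = i} eq = fromℕ< i<k , Fin.toℕ-fromℕ< i<k
  where
  i<k = ≤-trans (m≤n+m (suc i) r) (≤-reflexive eq)

module _ {m n : ℕ} (t : Vec ℕ m) (b : Vec ℕ n) where

  -- The bottom vertices from j on, r in number, and the top vertices from i on,
  -- s in number, have toppled once.
  burnt : (r i s j : ℕ) → Config m n
  burnt r i s j = fired n r i t , fired (suc m) s j b

  burn-top : ∀ {r s j} i → n ≤ lookup t i + r → (∀ j′ → j ≤ toℕ j′ → suc m ≤ lookup b j′ + s) →
             burnt r (suc (toℕ i)) s j ⟶ burnt r (toℕ i) (suc s) j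
  burn-top {r} {s} {j} i n≤ p =
    subst (burnt r (suc (toℕ i)) s j ⟶_)
      (cong₂ _,_ (updateAt-fired n r t i) (map-suc-fired (suc m) s j b p))
      (topples (inj₁ i) (≤-trans n≤ (≤-reflexive (sym (lookup-fired n r t i)))))

  burn-bottom : ∀ {r i s} j → suc m ≤ lookup b j + s → (∀ i′ → i ≤ toℕ i′ → n ≤ lookup t i′ + r) →
                burnt r i s (suc (toℕ j)) ⟶ burnt (suc r) i s (toℕ j)
  burn-bottom {r} {i} {s} j m< p =
    subst (burnt r i s (suc (toℕ j)) ⟶_)
      (cong₂ _,_ (map-suc-fired n r i t p) (updateAt-fired (suc m) s b j))
      (topples (inj₂ j) (≤-trans m< (≤-reflexive (sym (lookup-fired (suc m) s b j)))))

  burn-bottoms : (∀ j → suc m ≤ lookup b j) → ∀ r j → r + j ≡ n →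
                 burnt r m 0 j ⟶* burnt n m 0 0
  burn-bottoms p r zero eq with refl ← trans (sym (+-identityʳ r)) eq = ε
  burn-bottoms p r (suc j) eq with g , refl ← index r eq =
    burn-bottom g (≤-trans (p g) (m≤m+n _ 0)) (λ i m≤i → contradiction (Fin.toℕ<n i) (≤⇒≯ m≤i))
    ◅ burn-bottoms p (suc r) (toℕ g) (trans (sym (+-suc r (toℕ g))) eq)

Clear : Config m n → Set
Clear (t , b) = ∀ i j → toℕ j < lookup t i ⊎ toℕ i < lookup b j

module _ {m n : ℕ} (t : Vec ℕ m) (b : Vec ℕ n) (clear : Clear (t , b)) where

  private
    b⁺ : Vec ℕ n
    b⁺ = Vec.map suc b

    extend : ∀ {k deg r} {xs : Vec ℕ k} i → deg ≤ lookup xs i + r →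
             (∀ j → suc (toℕ i) ≤ toℕ j → deg ≤ lookup xs j + r) →
             (∀ j → toℕ i ≤ toℕ j → deg ≤ lookup xs j + r)
    extend {xs = xs} i deg≤ p j i≤j with m≤n⇒m<n∨m≡n i≤j
    ... | inj₁ i<j = p j i<j
    ... | inj₂ i≡j with refl ← Fin.toℕ-injective i≡j = deg≤

    weaken : ∀ {k deg r a} {xs : Vec ℕ k} → (∀ j → a ≤ toℕ j → deg ≤ lookup xs j + r) →
             (∀ j → a ≤ toℕ j → deg ≤ lookup xs j + suc r)
    weaken {r = r} {xs = xs} p j a≤j = ≤-trans (p j a≤j) (+-monoʳ-≤ (lookup xs j) (n≤1+n r))

  -- The premises say that the vertices toppled so far could afford it, so that the subtractions in
  -- `burnt` are exact.
  Burnable : (r i s j : ℕ) → Set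
  Burnable r i s j = (∀ i′ → i ≤ toℕ i′ → n ≤ lookup t i′ + r) →
                     (∀ j′ → j ≤ toℕ j′ → suc m ≤ lookup b⁺ j′ + s) →
                     burnt t b⁺ r i s j ⟶* burnt t b⁺ n 0 m 0

  -- Each of the r toppled bottom vertices has sent a grain, so j own grains, one for each bottom
  -- vertex still to topple, bring the top vertex to n.
  fire-top : ∀ r s j i → r + j ≡ n → j ≤ lookup t i →
             Burnable r (toℕ i) (suc s) j → Burnable r (suc (toℕ i)) s j
  fire-top r s j i eq j≤ rest p q =
    burn-top t b⁺ i n≤ q ◅ rest (extend {xs = t} i n≤ p) (weaken {xs = b⁺} q)
    where
    n≤ : n ≤ lookup t i + r
    n≤ = ≤-trans (≤-reflexive (trans (sym eq) (+-comm r j))) (+-monoˡ-≤ r j≤)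

  -- As for `fire-top`, with the sink as one more toppled neighbour: its grain is the increment in
  -- `b⁺`.
  fire-bottom : ∀ r i s j → s + i ≡ m → i ≤ lookup b j →
                Burnable (suc r) i s (toℕ j) → Burnable r i s (suc (toℕ j))
  fire-bottom r i s j eq i≤ rest p q =
    burn-bottom t b⁺ j m< p ◅ rest (weaken {xs = t} p) (extend {xs = b⁺} j m< q)
    where
    m< : suc m ≤ lookup b⁺ j + s
    m< = subst (λ x → suc m ≤ x + s) (sym (Vec.lookup-map j suc b))
      (s≤s (≤-trans (≤-reflexive (trans (sym eq) (+-comm s i))) (+-monoˡ-≤ s i≤)))

  -- While both sides have untoppled vertices, `clear` for the last ones, f and g, shows that one of
  -- them can topple. Once a side is exhausted, each remaining vertex has a grain from every
  -- neighbour.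
  burn : ∀ r i s j → r + j ≡ n → s + i ≡ m → Burnable r i s j
  burn r zero s zero eq eq′ _ _
    with refl ← trans (sym (+-identityʳ r)) eq | refl ← trans (sym (+-identityʳ s)) eq′ = ε
  burn r (suc i) s zero eq eq′
    with rest ← burn r i (suc s) zero eq (trans (sym (+-suc s i)) eq′) | f , refl ← index s eq′ =
    fire-top r s 0 f eq z≤n rest
  burn r zero s (suc j) eq eq′
    with rest ← burn (suc r) zero s j (trans (sym (+-suc r j)) eq) eq′ | g , refl ← index r eq =
    fire-bottom r 0 s g eq′ z≤n rest
  burn r (suc i) s (suc j) eq eq′
    with rest₁ ← burn r i (suc s) (suc j) eq (trans (sym (+-suc s i)) eq′)
       | rest₂ ← burn (suc r) (suc i) s j (trans (sym (+-suc r j)) eq) eq′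
       | f , refl ← index s eq′ | g , refl ← index r eq with clear f g
  ... | inj₁ g<t = fire-top r s (suc (toℕ g)) f eq g<t rest₁
  ... | inj₂ f<b = fire-bottom r (suc (toℕ f)) s g eq′ f<b rest₂

  -- When every vertex has toppled once, each has lost its degree and regained a grain from every
  -- neighbour, the sink included.
  fireSink-recurs : fireSink (t , b) ⟶* (t , b)
  fireSink-recurs = subst₂ _⟶*_
    (cong₂ _,_ (fired-none n t) (fired-none (suc m) b⁺))
    (cong₂ _,_ (trans (fired-all n n t) (trans (Vec.map-cong (λ x → m+n∸n≡m x n) t) (Vec.map-id t)))
       (trans (fired-all (suc m) m b⁺) (trans (sym (Vec.map-∘ (λ x → x + m ∸ suc m) suc b))
         (trans (Vec.map-cong (λ x → m+n∸n≡m x m) b) (Vec.map-id b)))))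
    (burn 0 m 0 n refl refl (λ i m≤i → contradiction (Fin.toℕ<n i) (≤⇒≯ m≤i))
       (λ j n≤j → contradiction (Fin.toℕ<n j) (≤⇒≯ n≤j)))

-- Counting avoiding sequences

sum-map-≤ : ∀ {A : Set} {f g : A → ℕ} {c} (xs : List A) → (∀ x → f x ≤ g x * c) →
            sum (List.map f xs) ≤ sum (List.map g xs) * c
sum-map-≤                 []       f≤g = z≤n
sum-map-≤ {g = g} {c} (x ∷ xs) f≤g =
  ≤-trans (+-mono-≤ (f≤g x) (sum-map-≤ xs f≤g)) (≤-reflexive (sym (*-distribʳ-+ c (g x) _)))

sum-map-≤-length : ∀ {A : Set} {f : A → ℕ} {c} (xs : List A) → (∀ x → f x ≤ c) →
                   sum (List.map f xs) ≤ List.length xs * c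
sum-map-≤-length []       f≤c = z≤n
sum-map-≤-length (x ∷ xs) f≤c = +-mono-≤ (f≤c x) (sum-map-≤-length xs f≤c)

length-≤-sum-map : ∀ {A : Set} {f : A → ℕ} {c} (xs : List A) → (∀ x → c ≤ f x) →
                   List.length xs * c ≤ sum (List.map f xs)
length-≤-sum-map []       c≤f = z≤n
length-≤-sum-map (x ∷ xs) c≤f = +-mono-≤ (c≤f x) (length-≤-sum-map xs c≤f)

sum-map-<-length : ∀ {A : Set} {f : A → ℕ} {c y} {xs : List A} → (∀ x → f x ≤ c) →
                   y ∈ xs → f y < c → sum (List.map f xs) < List.length xs * c
sum-map-<-length {xs = _ ∷ xs} f≤c (here refl) f<c = +-mono-<-≤ f<c (sum-map-≤-length xs f≤c)
sum-map-<-length {xs = x ∷ xs} f≤c (there y∈)  f<c =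
  +-mono-≤-< (f≤c x) (sum-map-<-length f≤c y∈ f<c)

≤-sum-map : ∀ {A : Set} (f : A → ℕ) {y} {xs : List A} → y ∈ xs → f y ≤ sum (List.map f xs)
≤-sum-map f {xs = _ ∷ xs} (here refl) = m≤m+n _ _
≤-sum-map f {xs = x ∷ xs} (there y∈)  = ≤-trans (≤-sum-map f y∈) (m≤n+m _ _)

length-map-allFin : ∀ {A : Set} k (f : Fin k → A) → List.length (List.map f (List.allFin k)) ≡ k
length-map-allFin k f =
  trans (List.length-map f (List.allFin k)) (List.length-tabulate (id {A = Fin k}))

length-vertices : ∀ m n → List.length (vertices m n) ≡ m + n
length-vertices m n = trans (List.length-++ (List.map inj₁ (List.allFin m)))
  (cong₂ _+_ (length-map-allFin m inj₁) (length-map-allFin n inj₂))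

∈-vertices : (v : Vertex m n) → v ∈ vertices m n
∈-vertices (inj₁ i) = ∈.∈-++⁺ˡ (∈.∈-map⁺ inj₁ (∈.∈-allFin i))
∈-vertices {m} (inj₂ j) = ∈.∈-++⁺ʳ (List.map inj₁ (List.allFin m)) (∈.∈-map⁺ inj₂ (∈.∈-allFin j))

m+n≢0 : ∀ m n .{{_ : NonZero n}} → NonZero (m + n)
m+n≢0 m n = >-nonZero (≤-trans (>-nonZero⁻¹ n) (m≤n+m n m))

module _ {m n : ℕ} .{{_ : NonZero n}} where

  stab-⟶* : (c : Config m n) → c ⟶* stab c
  stab-⟶* c = proj₁ (proj₂ (stabilisation c))

  stab-stable : (c : Config m n) → Stable (stab c)
  stab-stable c = proj₂ (proj₂ (stabilisation c))

  stab-id : (c : Config m n) → Stable c → c ≡ stab c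
  stab-id c stable = stable-⟶* stable (stab-⟶* c)

  avoidingNext : Config m n → ℕ → Config m n → Vertex m n → ℕ
  avoidingNext c τ d v = if does (next d v ≟ᶜ c) then 0 else avoiding c τ (next d v)

  avoiding-≤ : ∀ c τ d → avoiding c τ d ≤ (m + n) ^ τ
  avoidingNext-≤ : ∀ c τ d v → avoidingNext c τ d v ≤ (m + n) ^ τ

  avoiding-≤ c zero    d = ≤-refl
  avoiding-≤ c (suc τ) d = ≤-trans (sum-map-≤-length (vertices m n) (avoidingNext-≤ c τ d))
    (≤-reflexive (cong (_* (m + n) ^ τ) (length-vertices m n)))

  avoidingNext-≤ c τ d v with next d v ≟ᶜ c
  ... | yes _ = z≤n
  ... | no  _ = avoiding-≤ c τ (next d v)

  -- The Markov property: after τ steps the chain is at some stable configuration, from which at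
  -- most a continuations avoid c.
  avoiding-+ : ∀ c k a → (∀ d → Stable d → avoiding c k d ≤ a) →
               ∀ τ d → Stable d → avoiding c (τ + k) d ≤ avoiding c τ d * a
  avoiding-+ c k a p zero d stable = ≤-trans (p d stable) (≤-reflexive (sym (*-identityˡ a)))
  avoiding-+ c k a p (suc τ) d stable = sum-map-≤ (vertices m n) step
    where
    step : ∀ v → avoidingNext c (τ + k) d v ≤ avoidingNext c τ d v * a
    step v with next d v ≟ᶜ c
    ... | yes _ = z≤n
    ... | no  _ = avoiding-+ c k a p τ (next d v) (stab-stable (addGrain v d))

  avoiding-^ : ∀ c k a → (∀ d → Stable d → avoiding c k d ≤ a) →
               ∀ j d → Stable d → avoiding c (j * k) d ≤ a ^ j
  avoiding-^ c k a p zero    d stable = ≤-refl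
  avoiding-^ c k a p (suc j) d stable =
    ≤-trans (avoiding-+ c (j * k) (a ^ j) (avoiding-^ c k a p j) k d stable)
            (*-monoˡ-≤ (a ^ j) (p d stable))

  -- Grains are added to d one by one until, without intermediate topplings, it
  -- would have become z; by the abelian property the chain is then at c.
  avoiding-< : ∀ {c z} → z ⟶* c → Stable c → ∀ τ {d x} → x ⟶* d → x ≤ᶜ z → x ≢ z →
               total z ≤ total x + τ → avoiding c τ d < (m + n) ^ τ
  avoiding-< {z = z} z⟶*c stable τ {x = x} x⟶*d x≤z x≢z z≤ with climb x z x≤z
  ... | inj₁ x≡z = contradiction x≡z x≢z
  avoiding-< {z = z} z⟶*c stable zero {x = x} x⟶*d x≤z x≢z z≤
    | inj₂ (v , x⁺≤z) = contradiction
      (≤-trans z≤ (≤-reflexive (+-identityʳ _))) (<⇒≱ (climb-total v x z x⁺≤z))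
  avoiding-< {c} {z} z⟶*c stable (suc τ) {d} {x} x⟶*d x≤z x≢z z≤
    | inj₂ (v , x⁺≤z) = subst (λ k → avoiding c (suc τ) d < k * (m + n) ^ τ) (length-vertices m n)
      (sum-map-<-length (avoidingNext-≤ c τ d) (∈-vertices v) step)
    where
    x⁺⟶* : addGrain v x ⟶* next d v
    x⁺⟶* = gmap (addGrain v) (addGrain-⟶ v) x⟶*d ◅◅ stab-⟶* (addGrain v d)
    step : avoidingNext c τ d v < (m + n) ^ τ
    step with next d v ≟ᶜ c
    ... | yes _ = m^n>0 (m + n) {{m+n≢0 m n}} τ
    ... | no ≢c = avoiding-< z⟶*c stable τ x⁺⟶* x⁺≤z
      -- If the new x were z, the chain would by uniqueness of stabilisation now be at c.
      (λ { refl → ≢c (stabilisation-unique x⁺⟶* (stab-stable (addGrain v d)) z⟶*c stable) })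
      (≤-trans z≤ (≤-reflexive (trans (+-suc (total x) τ) (cong (_+ τ) (sym (total-addGrain v x))))))

-- Geometric decay of the probability of no return.

-- Bernoulli's inequality (1 + 1/a)^j ≥ 1 + j/a, cleared of denominators.
bernoulli : ∀ a j → a ^ j * (a + j) ≤ a * suc a ^ j
bernoulli a zero    = ≤-reflexive (eq a)
  where
  eq : ∀ a → 1 * (a + 0) ≡ a * 1
  eq = solve-∀
bernoulli a (suc j) = begin
  a * a ^ j * (a + suc j)                ≡⟨ eq₁ a (a ^ j) j ⟩
  a * (a ^ j * (a + j)) + a * a ^ j
    ≤⟨ +-mono-≤ (*-monoʳ-≤ a (bernoulli a j)) (*-monoʳ-≤ a (^-monoˡ-≤ j (n≤1+n a))) ⟩
  a * (a * suc a ^ j) + a * suc a ^ j    ≡⟨ eq₂ a (suc a ^ j) ⟩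
  a * (suc a * suc a ^ j)                ∎
  where
  open ≤-Reasoning
  eq₁ : ∀ a p j → a * p * (a + suc j) ≡ a * (p * (a + j)) + a * p
  eq₁ = solve-∀
  eq₂ : ∀ a p → a * (a * p) + a * p ≡ a * (suc a * p)
  eq₂ = solve-∀

geometric : ∀ a q → ∃[ j ] a ^ j * q < suc a ^ j
geometric zero      q = 1 , z<s
-- For j = a * q Bernoulli's inequality becomes a^j (1 + q) ≤ (1 + a)^j after cancelling a.
geometric a@(suc _) q = a * q , *-cancelˡ-< a _ _ (begin-strict
  a * (a ^ (a * q) * q)
    <⟨ *-monoʳ-< a (*-monoʳ-< (a ^ (a * q)) {{m^n≢0 a (a * q)}} (n<1+n q)) ⟩
  a * (a ^ (a * q) * suc q)           ≡⟨ eq a (a ^ (a * q)) q ⟩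
  a ^ (a * q) * (a + a * q)           ≤⟨ bernoulli a (a * q) ⟩
  a * suc a ^ (a * q)                 ∎)
  where
  open ≤-Reasoning
  eq : ∀ a p q → a * (p * suc q) ≡ p * (a + a * q)
  eq = solve-∀

/-<-intro : ∀ a d .{{_ : NonZero d}} p q .{{_ : NonZero q}} →
            a * q < p * d → (ℤ.+ a) / d ℚ.< (ℤ.+ p) / q
/-<-intro a (suc d) p (suc q) lt =
  *<* (subst₂ ℤ._<_ (ℤ.pos-* a (suc q)) (ℤ.pos-* p (suc d)) (ℤ.+<+ lt))

/-<-elim : ∀ a d .{{_ : NonZero d}} p q .{{_ : NonZero q}} →
           (ℤ.+ a) / d ℚ.< (ℤ.+ p) / q → a * q < p * d
/-<-elim a (suc d) p (suc q) (*<* lt) =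
  ℤ.drop‿+<+ (subst₂ ℤ._<_ (sym (ℤ.pos-* a (suc q))) (sym (ℤ.pos-* p (suc d))) lt)

module _ {m n : ℕ} .{{_ : NonZero n}} where

  -- In each block of k steps at least one of the (m + n)^k sequences visits c, so j blocks are
  -- survived by at most ((m + n)^k - 1)^j sequences.
  bounded⇒recurrent : ∀ {c : Config m n} {k} → Stable c →
    (∀ d → Stable d → avoiding c k d < (m + n) ^ k) → DeterministicallyRecurrent c
  bounded⇒recurrent {c} {k} stable p = stable , recurs
    where
    a = pred ((m + n) ^ k)
    1+a≡ : suc a ≡ (m + n) ^ k
    1+a≡ = suc-pred ((m + n) ^ k) {{m^n≢0 (m + n) k {{m+n≢0 m n}}}}
    p′ : ∀ d → Stable d → avoiding c k d ≤ a
    p′ d s = s≤s⁻¹ (subst (avoiding c k d <_) (sym 1+a≡) (p d s))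
    recurs : ∀ δ → ℚ.0ℚᵘ ℚ.< δ → ∃[ τ ] noReturn c τ ℚ.< δ
    recurs (mkℚᵘ (ℤ.+ zero) q) (*<* (ℤ.+<+ ()))
    recurs (mkℚᵘ ℤ.-[1+ x ] q) (*<* ())
    -- The given bound is at least 1 / (1 + q), so j is chosen to go below that.
    recurs (mkℚᵘ (ℤ.+ suc x) q) _ with j , lt ← geometric a (suc q) =
      j * k , /-<-intro _ ((m + n) ^ (j * k)) {{m^n≢0 (m + n) (j * k) {{m+n≢0 m n}}}} (suc x) (suc q) (begin-strict
        avoiding c (j * k) c * suc q   ≤⟨ *-monoˡ-≤ (suc q) (avoiding-^ c k a p′ j c stable) ⟩
        a ^ j * suc q                  <⟨ lt ⟩
        suc a ^ j                      ≡⟨ cong (_^ j) 1+a≡ ⟩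
        ((m + n) ^ k) ^ j              ≡⟨ ^-*-assoc (m + n) k j ⟩
        (m + n) ^ (k * j)              ≡⟨ cong ((m + n) ^_) (*-comm k j) ⟩
        (m + n) ^ (j * k)              ≤⟨ m≤m+n ((m + n) ^ (j * k)) _ ⟩
        suc x * (m + n) ^ (j * k)      ∎)
      where open ≤-Reasoning

-- Recurrence of clear configurations.

fireSink^ : ℕ → Config m n → Config m n
fireSink^ zero    c = c
fireSink^ (suc k) c = fireSink (fireSink^ k c)

fireSink^-recurs : ∀ {c : Config m n} → fireSink c ⟶* c → ∀ k → fireSink^ k c ⟶* c
fireSink^-recurs p zero    = ε
fireSink^-recurs p (suc k) = gmap fireSink fireSink-⟶ (fireSink^-recurs p k) ◅◅ p

fireSink^-+ : ∀ k (t : Vec ℕ m) (b : Vec ℕ n) → fireSink^ k (t , b) ≡ (t , Vec.map (k +_) b)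
fireSink^-+ zero    t b = cong (t ,_) (sym (Vec.map-id b))
fireSink^-+ (suc k) t b rewrite fireSink^-+ k t b = cong (t ,_) (sym (Vec.map-∘ suc (k +_) b))

-- Dominates every stable configuration. It arises from c by firing the sink 2 (m + 1) times and
-- then toppling each bottom vertex once.
saturate : Config m n → Config m n
saturate {m} {n} (t , b) = Vec.map (_+ n) t , Vec.map (suc m +_) b

module _ {m n : ℕ} (c : Config m n) (clear : Clear c) where

  private
    t = proj₁ c
    b = proj₂ c
    b⁺⁺ = Vec.map ((suc m + suc m) +_) b

  fireSink-⟶*-saturate : fireSink^ (suc m + suc m) c ⟶* saturate c
  fireSink-⟶*-saturate = subst₂ _⟶*_
    (trans (cong₂ _,_ (fired-none n t) (fired-none (suc m) b⁺⁺)) (sym (fireSink^-+ (suc m + suc m) t b)))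
    (cong₂ _,_ (fired-add n n t)
      (trans (fired-all (suc m) 0 b⁺⁺) (trans (sym (Vec.map-∘ _ _ b)) (Vec.map-cong unfire b))))
    (burn-bottoms t b⁺⁺ large 0 n refl)
    where
    large : ∀ j → suc m ≤ lookup b⁺⁺ j
    large j = ≤-trans (≤-trans (m≤m+n (suc m) (suc m)) (m≤m+n _ (lookup b j)))
      (≤-reflexive (sym (Vec.lookup-map j _ b)))
    unfire : ∀ x → suc m + suc m + x + 0 ∸ suc m ≡ suc m + x
    unfire x = trans (cong (_∸ suc m) (trans (+-identityʳ _) (+-assoc (suc m) (suc m) x)))
      (m+n∸m≡n (suc m) (suc m + x))

  -- The repeatedly fired configuration stabilises to c, and by the abelian property so does the
  -- intermediate `saturate c`.
  saturate-⟶* : Stable c → saturate c ⟶* c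
  saturate-⟶* stable = ⟶*-stabilises fireSink-⟶*-saturate
    (fireSink^-recurs (fireSink-recurs t b clear) (suc m + suc m)) stable

≤-saturate : (c d : Config m n) → Stable d → d ≤ᶜ saturate c
≤-saturate {n = n} (t , b) d stable (inj₁ i) = ≤-trans (<⇒≤ (stable (inj₁ i)))
  (≤-trans (m≤n+m n (lookup t i)) (≤-reflexive (sym (Vec.lookup-map i (_+ n) t))))
≤-saturate {m} (t , b) d stable (inj₂ j) = ≤-trans (<⇒≤ (stable (inj₂ j)))
  (≤-trans (m≤m+n (suc m) (lookup b j)) (≤-reflexive (sym (Vec.lookup-map j (suc m +_) b))))

-- Ensures that at least one grain has to be added, since `avoiding` does not count a visit at time
-- 0.
saturate-unstable : (c : Config m (suc n)) → ¬ Stable (saturate c)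
saturate-unstable {m} (t , x ∷ b) stable = <⇒≱ (stable (inj₂ zero)) (m≤m+n (suc m) x)

clear⇒recurrent : ∀ {m n} (c : Config m (suc n)) → Stable c → Clear c → DeterministicallyRecurrent c
-- The total of `saturate c` bounds the number of grains to be added, uniformly in the starting
-- configuration.
clear⇒recurrent c stable clear = bounded⇒recurrent {k = total (saturate c)} stable
  (λ d d-stable → avoiding-< (saturate-⟶* c clear stable) stable (total (saturate c)) ε
     (≤-saturate c d d-stable) (λ { refl → saturate-unstable c d-stable }) (m≤n+m _ (total d)))

-- Forbidden subconfigurations

#< : ℕ → Vec ℕ k → ℕ
#< b = Vec.count (_<? b)

#<-zero : (xs : Vec ℕ k) → #< 0 xs ≡ 0
#<-zero []       = refl
#<-zero (x ∷ xs) = #<-zero xs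

#<-map-suc : ∀ b (xs : Vec ℕ k) → #< (suc b) (Vec.map suc xs) ≡ #< b xs
#<-map-suc b []       = refl
#<-map-suc b (x ∷ xs) rewrite #<-map-suc b xs = refl

#<-∷ : ∀ b x (xs : Vec ℕ k) →
       (x < b × #< b (x ∷ xs) ≡ suc (#< b xs)) ⊎ (b ≤ x × #< b (x ∷ xs) ≡ #< b xs)
#<-∷ b x xs with x <? b
... | yes x<b = inj₁ (x<b , cong (λ p → (if p then suc else id) (#< b xs)) (dec-true (x <? b) x<b))
... | no  x≮b = inj₂ (≮⇒≥ x≮b , cong (λ p → (if p then suc else id) (#< b xs)) (dec-false (x <? b) x≮b))

#<-∷-≥ : ∀ b x (xs : Vec ℕ k) → #< b xs ≤ #< b (x ∷ xs)
#<-∷-≥ b x xs with #<-∷ b x xs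
... | inj₁ (_ , eq) = ≤-trans (n≤1+n _) (≤-reflexive (sym eq))
... | inj₂ (_ , eq) = ≤-reflexive (sym eq)

#<-∷-≤ : ∀ b x (xs : Vec ℕ k) → #< b (x ∷ xs) ≤ suc (#< b xs)
#<-∷-≤ b x xs with #<-∷ b x xs
... | inj₁ (_ , eq) = ≤-reflexive eq
... | inj₂ (_ , eq) = ≤-trans (≤-reflexive eq) (n≤1+n _)

#<-∷-mono : ∀ b {x y j} (xs ys : Vec ℕ k) → y ≤ x → #< b xs ≤ j + #< b ys →
            #< b (x ∷ xs) ≤ j + #< b (y ∷ ys)
#<-∷-mono b {x} {y} {j} xs ys y≤x p with #<-∷ b x xs | #<-∷ b y ys
... | inj₁ (x<b , eq) | inj₁ (_ , eq′) rewrite eq | eq′ = ≤-trans (s≤s p) (≤-reflexive (sym (+-suc j _)))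
... | inj₁ (x<b , eq) | inj₂ (b≤y , _) = contradiction (≤-trans b≤y y≤x) (<⇒≱ x<b)
... | inj₂ (b≤x , eq) | _ = ≤-trans (≤-reflexive eq) (≤-trans p (+-monoʳ-≤ j (#<-∷-≥ b y ys)))

#<-updateAt : ∀ b (xs : Vec ℕ k) i (f : ℕ → ℕ) → #< b (updateAt xs i f) ≤ 1 + #< b xs
#<-updateAt b (x ∷ xs) zero    f = ≤-trans (#<-∷-≤ b (f x) xs) (s≤s (#<-∷-≥ b x xs))
#<-updateAt b (x ∷ xs) (suc i) f =
  #<-∷-mono b {j = 1} (updateAt xs i f) xs ≤-refl (#<-updateAt b xs i f)

#<-updateAt-suc : ∀ b (xs : Vec ℕ k) i → #< b (updateAt xs i suc) ≤ #< b xs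
#<-updateAt-suc b (x ∷ xs) zero    = #<-∷-mono b {j = 0} xs xs (n≤1+n x) ≤-refl
#<-updateAt-suc b (x ∷ xs) (suc i) =
  #<-∷-mono b {j = 0} (updateAt xs i suc) xs ≤-refl (#<-updateAt-suc b xs i)

#<-replicate : ∀ k b x → b ≤ x → #< b (Vec.replicate k x) ≡ 0
#<-replicate zero    b x b≤x = refl
#<-replicate (suc k) b x b≤x with #<-∷ b x (Vec.replicate k x)
... | inj₁ (x<b , _) = contradiction b≤x (<⇒≱ x<b)
... | inj₂ (_ , eq)  = trans eq (#<-replicate k b x b≤x)

-- In a sorted vector the entries below b form an initial segment.
#<-sorted : ∀ b (xs : Vec ℕ k) → Linked _≤_ xs → ∀ i → lookup xs i < b → toℕ i < #< b xs
#<-sorted b (x ∷ xs) xs≤ i <b with #<-∷ b x xs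
... | inj₂ (b≤x , _) = contradiction
  (≤-<-trans (All.lookup⁺ (Linked.Linked⇒All ≤-trans ≤-refl xs≤) i) <b) (≤⇒≯ b≤x)
#<-sorted b (x ∷ xs) xs≤ zero    <b | inj₁ (_ , eq) = ≤-trans z<s (≤-reflexive (sym eq))
#<-sorted b (x ∷ xs) xs≤ (suc i) <b | inj₁ (_ , eq) =
  ≤-trans (s<s (#<-sorted b xs (Linked.tail xs≤) i <b)) (≤-reflexive (sym eq))

-- There are no a + 1 top and b + 1 bottom vertices each of which has fewer
-- grains than neighbours among the others.
Free : Config m n → Set
Free (t , bs) = ∀ a b → a < #< (suc b) t → b < #< (suc a) bs → ⊥

free-addGrain : ∀ v (c : Config m n) → Free c → Free (addGrain v c)
free-addGrain (inj₁ i) (t , bs) free a b a< = free a b (≤-trans a< (#<-updateAt-suc (suc b) t i))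
free-addGrain (inj₂ j) (t , bs) free a b a< b< =
  free a b a< (≤-trans b< (#<-updateAt-suc (suc a) bs j))

-- A forbidden subconfiguration containing the toppled vertex was forbidden
-- without that vertex before.
free-topple : ∀ v (c : Config m n) → Free c → Free (topple v c)
free-topple (inj₁ i) (t , bs) free zero b a< b< =
  contradiction (subst (b <_) (trans (#<-map-suc 0 bs) (#<-zero bs)) b<) λ ()
free-topple {n = n} (inj₁ i) (t , bs) free (suc a) b a< b< =
  free a b (s≤s⁻¹ (≤-trans a< (#<-updateAt (suc b) t i (_∸ n)))) (subst (b <_) (#<-map-suc (suc a) bs) b<)
free-topple (inj₂ j) (t , bs) free a zero a< b< =
  contradiction (subst (a <_) (trans (#<-map-suc 0 t) (#<-zero t)) a<) λ ()
free-topple {m} (inj₂ j) (t , bs) free a (suc b) a< b< =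
  free a b (subst (a <_) (#<-map-suc (suc b) t) a<) (s≤s⁻¹ (≤-trans b< (#<-updateAt (suc a) bs j (_∸ suc m))))

free-⟶* : ∀ {c d : Config m n} → c ⟶* d → Free c → Free d
free-⟶* ε                       free = free
free-⟶* {c = c} (topples v _ ◅ p) free = free-⟶* p (free-topple v c free)

-- Transience of configurations that are not free.

full : ∀ m n → Config m (suc n)
full m n = Vec.replicate m n , Vec.replicate (suc n) m

-- Among m top vertices a + 1 can be chosen only if a < m, and no bottom vertex of `full` has as few
-- as a grains then.
full-free : ∀ m n → Free (full m n)
full-free m n a b a< b< = contradiction
  (subst (b <_) (#<-replicate (suc n) (suc a) m (≤-trans a< (Vec.count≤n _ (Vec.replicate m n)))) b<) λ ()

stable⇒≤-full : (c : Config m (suc n)) → Stable c → c ≤ᶜ full m n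
stable⇒≤-full {m} {n} c stable (inj₁ i) =
  ≤-trans (s≤s⁻¹ (stable (inj₁ i))) (≤-reflexive (sym (Vec.lookup-replicate i n)))
stable⇒≤-full {m} {n} c stable (inj₂ j) =
  ≤-trans (s≤s⁻¹ (stable (inj₂ j))) (≤-reflexive (sym (Vec.lookup-replicate j m)))

≤-full⇒stable : (c : Config m (suc n)) → c ≤ᶜ full m n → Stable c
≤-full⇒stable {m} {n} c c≤ (inj₁ i) =
  s≤s (≤-trans (c≤ (inj₁ i)) (≤-reflexive (Vec.lookup-replicate i n)))
≤-full⇒stable {m} {n} c c≤ (inj₂ j) =
  s≤s (≤-trans (c≤ (inj₂ j)) (≤-reflexive (Vec.lookup-replicate j m)))

module _ {m n : ℕ} {c : Config m (suc n)} (¬free : ¬ Free c) where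

  private
    M K : ℕ
    M = m + suc n
    K = total (full m n)

    instance
      M≢0 : NonZero M
      M≢0 = m+n≢0 m (suc n)
      M^K≢0 : NonZero (M ^ K)
      M^K≢0 = m^n≢0 M K

  -- The chain preserves freeness, so from a free configuration every sequence avoids c, which is
  -- not free.
  free-avoiding : ∀ τ d → Free d → M ^ τ ≤ avoiding c τ d
  free-avoiding zero    d free = ≤-refl
  free-avoiding (suc τ) d free =
    subst (λ k → k * M ^ τ ≤ avoiding c (suc τ) d) (length-vertices m (suc n))
      (length-≤-sum-map (vertices m (suc n)) step)
    where
    step : ∀ v → M ^ τ ≤ avoidingNext c τ d v
    step v with next d v ≟ᶜ c | free-⟶* (stab-⟶* (addGrain v d)) (free-addGrain v d free)
    ... | yes refl | free′ = contradiction free′ ¬free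
    ... | no  _    | free′ = free-avoiding τ (next d v) free′

  -- Filling d up to `full` causes no toppling and misses c because the total exceeds that of c. At
  -- most k steps are prescribed in this way, hence the factor M ^ k; `full` is free, so afterwards
  -- all sequences avoid c.
  climb-avoiding : ∀ k τ d → d ≤ᶜ full m n → total c ≤ total d → total (full m n) ≤ total d + k →
                   M ^ τ ≤ avoiding c τ d * M ^ k
  climb-avoiding k τ d d≤ c≤d ≤k with climb d (full m n) d≤
  ... | inj₁ refl = ≤-trans (free-avoiding τ d (full-free m n)) (m≤m*n _ (M ^ k) {{m^n≢0 M k}})
  climb-avoiding zero τ d d≤ c≤d ≤k | inj₂ (v , d⁺≤) =
    contradiction (≤-trans ≤k (≤-reflexive (+-identityʳ _))) (<⇒≱ (climb-total v d _ d⁺≤))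
  climb-avoiding (suc k) zero d d≤ c≤d ≤k | inj₂ _ =
    ≤-trans (m^n>0 M (suc k)) (≤-reflexive (sym (*-identityˡ _)))
  climb-avoiding (suc k) (suc τ) d d≤ c≤d ≤k | inj₂ (v , d⁺≤) = begin
    M * M ^ τ                              ≤⟨ *-monoʳ-≤ M rest ⟩
    M * (avoiding c τ d⁺ * M ^ k)          ≡⟨ eq M (avoiding c τ d⁺) (M ^ k) ⟩
    avoiding c τ d⁺ * (M * M ^ k)          ≤⟨ *-monoˡ-≤ (M * M ^ k) step ⟩
    avoiding c (suc τ) d * (M * M ^ k)     ∎
    where
    open ≤-Reasoning
    d⁺ = addGrain v d
    c<d⁺ : total c < total d⁺
    c<d⁺ = subst (total c <_) (sym (total-addGrain v d)) (s≤s c≤d)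
    rest : M ^ τ ≤ avoiding c τ d⁺ * M ^ k
    rest = climb-avoiding k τ d⁺ d⁺≤ (<⇒≤ c<d⁺) (≤-trans ≤k (≤-reflexive
      (trans (+-suc (total d) k) (cong (_+ k) (sym (total-addGrain v d))))))
    eq : ∀ m x y → m * (x * y) ≡ x * (m * y)
    eq = solve-∀
    step′ : avoiding c τ d⁺ ≤ avoidingNext c τ d v
    step′ with next d v ≟ᶜ c | stab-id d⁺ (≤-full⇒stable d⁺ d⁺≤)
    ... | yes refl | d⁺≡ = contradiction (cong total (sym d⁺≡)) (<⇒≢ c<d⁺)
    ... | no  _    | d⁺≡ = ≤-reflexive (cong (avoiding c τ) d⁺≡)
    step : avoiding c τ d⁺ ≤ avoiding c (suc τ) d
    step = ≤-trans step′ (≤-sum-map (avoidingNext c τ d) (∈-vertices v))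

  ¬free⇒¬recurrent : ¬ DeterministicallyRecurrent c
  -- By `climb-avoiding` the probability of no return stays at or above 1 / M ^ K at all times.
  ¬free⇒¬recurrent (stable , recurs) = refute (recurs (ℤ.+ 1 / M ^ K) (/-<-intro 0 1 1 (M ^ K) z<s))
    where
    refute : ¬ (∃[ τ ] noReturn c τ ℚ.< ℤ.+ 1 / M ^ K)
    refute (τ , lt) = contradiction (/-<-elim _ (M ^ τ) {{m^n≢0 M τ}} 1 (M ^ K) lt)
      (≤⇒≯ (≤-trans (≤-reflexive (*-identityˡ _))
        (climb-avoiding K τ c (stable⇒≤-full c stable) ≤-refl (m≤n+m K (total c)))))

-- By sortedness a violating pair (i , j) yields i + 1 top vertices with at most j grains and j + 1
-- bottom vertices with at most i grains.
recurrent⇒clear : ∀ {m n} (c : Config m (suc n)) → Sorted c → DeterministicallyRecurrent c → Clear c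
recurrent⇒clear c@(t , b) (t≤ , b≤) recurrent i j with toℕ j <? lookup t i | toℕ i <? lookup b j
... | yes j<t | _       = inj₁ j<t
... | no  _   | yes i<b = inj₂ i<b
... | no  j≮t | no  i≮b = contradiction
  (λ free → free (toℕ i) (toℕ j) (#<-sorted (suc (toℕ j)) t t≤ i (s≤s (≮⇒≥ j≮t)))
                                 (#<-sorted (suc (toℕ i)) b b≤ j (s≤s (≮⇒≥ i≮b))))
  (λ ¬free → ¬free⇒¬recurrent ¬free recurrent)

-- Recurrent configurations and words

lookup-∷ʳ-fromℕ : ∀ (xs : Vec ℕ k) x → lookup (xs Vec.∷ʳ x) (fromℕ k) ≡ x
lookup-∷ʳ-fromℕ []       x = refl
lookup-∷ʳ-fromℕ (y ∷ xs) x = lookup-∷ʳ-fromℕ xs x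

lookup-∷ʳ-inject₁ : ∀ (xs : Vec ℕ k) x i → lookup (xs Vec.∷ʳ x) (inject₁ i) ≡ lookup xs i
lookup-∷ʳ-inject₁ (y ∷ xs) x zero    = refl
lookup-∷ʳ-inject₁ (y ∷ xs) x (suc i) = lookup-∷ʳ-inject₁ xs x i

linked-∷ʳ⁺ : ∀ {xs : Vec ℕ k} {x} →
             Linked _≤_ xs → (∀ i → lookup xs i ≤ x) → Linked _≤_ (xs Vec.∷ʳ x)
linked-∷ʳ⁺ []        ≤x = [-]
linked-∷ʳ⁺ [-]       ≤x = ≤x zero ∷ [-]
linked-∷ʳ⁺ (_∷_ {xs = _ ∷ _} y≤ xs≤) ≤x = y≤ ∷ linked-∷ʳ⁺ xs≤ (≤x ∘ suc)

linked-∷ʳ⁻ : ∀ (xs : Vec ℕ k) {x} → Linked _≤_ (xs Vec.∷ʳ x) → Linked _≤_ xs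
linked-∷ʳ⁻ []           _          = []
linked-∷ʳ⁻ (_ ∷ [])     _          = [-]
linked-∷ʳ⁻ (_ ∷ y ∷ xs) (x≤ ∷ xs≤) = x≤ ∷ linked-∷ʳ⁻ (y ∷ xs) xs≤

linked⇒≤-last : {xs : Vec ℕ (suc k)} → Linked _≤_ xs → ∀ i → lookup xs i ≤ lookup xs (fromℕ k)
linked⇒≤-last {k} xs≤ i with m≤n⇒m<n∨m≡n (Fin.≤fromℕ i)
... | inj₁ i<k = Linked.lookup⁺ ≤-trans xs≤ i<k
... | inj₂ i≡k with refl ← Fin.toℕ-injective i≡k = ≤-refl

-- By stability the last top vertex has at most n grains, so `Clear` for the two last vertices
-- forces the last bottom vertex to have its maximum.
clear⇒last : ∀ m {n} (t : Vec ℕ m) (b : Vec ℕ (suc n)) → Stable (t , b) → Clear (t , b) →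
             lookup b (fromℕ n) ≡ m
clear⇒last m t b stable clear = ≤-antisym (s≤s⁻¹ (stable (inj₂ _))) (lower-bound m t b stable clear)
  where
  lower-bound : ∀ m {n} (t : Vec ℕ m) (b : Vec ℕ (suc n)) → Stable (t , b) → Clear (t , b) →
                m ≤ lookup b (fromℕ n)
  lower-bound zero    t b stable clear = z≤n
  lower-bound (suc m) {n} t b stable clear with clear (fromℕ m) (fromℕ n)
  ... | inj₁ n<t = contradiction
    (subst (_< lookup t (fromℕ m)) (Fin.toℕ-fromℕ n) n<t) (≤⇒≯ (s≤s⁻¹ (stable (inj₁ _))))
  ... | inj₂ m<b = subst (_< lookup b (fromℕ n)) (Fin.toℕ-fromℕ m) m<b

clear⇒balanced : (t : Vec ℕ m) (b : Vec ℕ (suc n)) → Stable (t , b) → Clear (t , b) →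
                 Balanced 0 (t Vec.∷ʳ n) b
clear⇒balanced {m} {n} t b stable clr = record
  { lastᵀ = lookup-∷ʳ-fromℕ t n
  ; lastᴮ = clear⇒last m t b stable clr
  ; clear = cl
  }
  where
  cl : ∀ i j → toℕ i + toℕ j < m + n → toℕ j < lookup (t Vec.∷ʳ n) i ⊎ toℕ i < lookup b j
  cl i j i+j< with view i
  -- For the sentinel, at position m with value n, the bound on the positions gives j < n.
  ... | ‵fromℕ rewrite lookup-∷ʳ-fromℕ t n | Fin.toℕ-fromℕ m = inj₁ (+-cancelˡ-< m _ _ i+j<)
  ... | ‵inject₁ i′ rewrite lookup-∷ʳ-inject₁ t n i′ | Fin.toℕ-inject₁ i′ = clr i′ j

parse⇒clear : (t : Vec ℕ m) (b : Vec ℕ (suc n)) → Parse 0 (t Vec.∷ʳ n) b w → Clear (t , b)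
parse⇒clear {m} {n} t b p i j
  with clr ← clear (parse⇒balanced p) (inject₁ i) j
  rewrite lookup-∷ʳ-inject₁ t n i | Fin.toℕ-inject₁ i
  = clr (+-mono-<-≤ (Fin.toℕ<n i) (s≤s⁻¹ (Fin.toℕ<n j)))

-- Sorted stacks are bounded by their last entries, which are n and m.
parse⇒stable : (t : Vec ℕ m) (b : Vec ℕ (suc n)) → Parse 0 (t Vec.∷ʳ n) b w → Stable (t , b)
parse⇒stable {m} {n} t b p (inj₁ i) = s≤s (subst₂ _≤_ (lookup-∷ʳ-inject₁ t n i) (lookup-∷ʳ-fromℕ t n)
  (linked⇒≤-last (proj₁ (parse⇒linked p)) (inject₁ i)))
parse⇒stable t b p (inj₂ j) = s≤s (subst (lookup b j ≤_) (lastᴮ (parse⇒balanced p))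
  (linked⇒≤-last (proj₂ (parse⇒linked p)) j))

parse⇒sortedRecurrent : (t : Vec ℕ m) (b : Vec ℕ (suc n)) → Parse 0 (t Vec.∷ʳ n) b w →
                        SortedRecurrent (t , b)
parse⇒sortedRecurrent t b p with T≤ , b≤ ← parse⇒linked p =
  (linked-∷ʳ⁻ t T≤ , b≤) , clear⇒recurrent (t , b) (parse⇒stable t b p) (parse⇒clear t b p)

sortedRecurrent⇒parse : (t : Vec ℕ m) (b : Vec ℕ (suc n)) → SortedRecurrent (t , b) →
                        ∃[ w ] Parse 0 (t Vec.∷ʳ n) b w
sortedRecurrent⇒parse {n = n} t b@(_ ∷ _) ((t≤ , b≤) , recurrent@(stable , _)) =
  parse (t Vec.∷ʳ n) b (linked-∷ʳ⁺ t≤ (λ i → s≤s⁻¹ (stable (inj₁ i)))) b≤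
    (clear⇒balanced t b stable (recurrent⇒clear (t , b) (t≤ , b≤) recurrent))
  where
  parse : ∀ {k l} (T : Vec ℕ (suc k)) (B : Vec ℕ (suc l)) → Linked _≤_ T → Linked _≤_ B →
          Balanced 0 T B → ∃[ w ] Parse 0 T B w
  parse (x ∷ T) (y ∷ B) = balanced⇒parse x T y B

dropLast-∷ʳ : ∀ {A : Set} (xs : List A) x → dropLast (xs ∷ʳ x) ≡ xs
dropLast-∷ʳ []           x = refl
dropLast-∷ʳ (y ∷ [])     x = refl
dropLast-∷ʳ (y ∷ z ∷ xs) x = cong (y ∷_) (dropLast-∷ʳ (z ∷ xs) x)

parse⇒word : (t : Vec ℕ m) (b : Vec ℕ (suc n)) → Parse 0 (t Vec.∷ʳ n) b w → word (t , b) ≡ w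
parse⇒word {w = w} t b p = trans (cong dropLast (parse⇒run p)) (dropLast-∷ʳ w D)

parse⇒Φ : (t : Vec ℕ m) (b : Vec ℕ (suc n)) → Parse 0 (t Vec.∷ʳ n) b w →
          Φ (t , b) ≡ (upperPath w , lowerPath w)
parse⇒Φ {m} {n} {w} t b p with u , l ← parse⇒paths p = cong₂ _,_
  (begin
    stairs N E (suc n) 0 (Vec.map suc t Vec.∷ʳ suc n)      ≡⟨ cong (stairs N E (suc n) 0) (Vec.map-∷ʳ suc n t) ⟨
    stairs N E (suc n) 0 (Vec.map suc (t Vec.∷ʳ n))        ≡⟨ stairs-suc N E n (t Vec.∷ʳ n) ⟩
    N ∷ stairs N E n 0 (t Vec.∷ʳ n)
      ≡⟨ cong (λ e → N ∷ stairs N E e 0 (t Vec.∷ʳ n)) (lookup-∷ʳ-fromℕ t n) ⟨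
    N ∷ path N E (t Vec.∷ʳ n)                              ≡⟨ cong (N ∷_) u ⟩
    upperPath w                                            ∎)
  (begin
    stairs E N (suc m) 0 (Vec.map suc b)                   ≡⟨ stairs-suc E N m b ⟩
    E ∷ stairs E N m 0 b
      ≡⟨ cong (λ e → E ∷ stairs E N e 0 b) (lastᴮ (parse⇒balanced p)) ⟨
    E ∷ path E N b                                         ≡⟨ cong (E ∷_) l ⟩
    lowerPath w                                            ∎)
  where open ≡-Reasoning

parse⇒polyomino : {T : Vec ℕ (suc m)} {B : Vec ℕ (suc n)} → Parse 0 T B w →
                  IsPolyomino m (suc n) (upperPath w , lowerPath w)
parse⇒polyomino {w = w} p with (uˣ , uʸ) , lˣ , lʸ ← parse⇒ends p = polyomino (parse⇒motzkin p)
  (trans (cong (λ { (x , y) → x , suc y }) (end-∷ʳᴱ (List.map upper w)))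
    (cong₂ (λ x y → suc x , suc y) uˣ uʸ))
  (trans (cong (λ { (x , y) → suc x , y }) (end-∷ʳᴺ (List.map lower w)))
    (cong₂ (λ x y → suc x , suc y) lˣ lʸ))

inner-paths : ∀ w → List.zipWith combine (inner (upperPath w)) (inner (lowerPath w)) ≡ w
inner-paths w = trans (cong₂ (List.zipWith combine)
  (dropLast-∷ʳ (List.map upper w) E) (dropLast-∷ʳ (List.map lower w) N))
  (zipWith-combine w)

parse⇒ΞΦ : (t : Vec ℕ m) (b : Vec ℕ (suc n)) → Parse 0 (t Vec.∷ʳ n) b w →
           Σ[ p ∈ IsPolyomino m (suc n) (Φ (t , b)) ] w ≡ Ξ (Φ (t , b) , p)
parse⇒ΞΦ {m} {n} {w} t b p = transport (sym (parse⇒Φ t b p))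
  where
  transport : ∀ {paths} → (upperPath w , lowerPath w) ≡ paths →
              Σ[ q ∈ IsPolyomino m (suc n) paths ] w ≡ Ξ (paths , q)
  transport refl = parse⇒polyomino p , sym (inner-paths w)

parse⇒motz : {T : Vec ℕ (suc m)} {B : Vec ℕ (suc n)} → Parse 0 T B w → Motz m n w
parse⇒motz p = parse⇒motzkin p , trans (sym (+-identityʳ _)) (parse-length p) ,
  trans (sym (+-identityʳ _)) (parse-#U+Hᴱ p)

-- The number of `U` and `Hᴱ` fixes the size of the top stack, the length that of the bottom stack,
-- and `lastᵀ` shows that the last top entry is the sentinel.
motz⇒parse : Motz m n w → Σ[ t ∈ Vec ℕ m ] Σ[ b ∈ Vec ℕ (suc n) ] Parse 0 (t Vec.∷ʳ n) b w
motz⇒parse {m} {n} {w} (motzkin , len , #U) with k , l , T , B , p ← motzkin⇒parse motzkin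
  with refl ← trans (sym (parse-#U+Hᴱ p)) (trans (+-identityʳ _) #U)
  with refl ← +-cancelˡ-≡ m l n (trans (sym (parse-length p)) (trans (+-identityʳ _) len))
  with t , x , refl ← Vec.initLast T
  with refl ← trans (sym (lookup-∷ʳ-fromℕ t x)) (lastᵀ (parse⇒balanced p)) = t , B , p

-- The bijection between configurations and words.

word-bijection : ∀ m n → BijectionBetween SortedRecurrent (Motz m n) (word {m} {suc n})
word-bijection m n = maps , (λ {x} {y} → injective {x} {y}) , surjective
  where
  maps : ∀ {c : Config m (suc n)} → SortedRecurrent c → Motz m n (word c)
  maps {t , b} r with w , p ← sortedRecurrent⇒parse t b r =
    subst (Motz m n) (sym (parse⇒word t b p)) (parse⇒motz p)

  injective : ∀ {x y : Σ[ c ∈ Config m (suc n) ] SortedRecurrent c} →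
              word (proj₁ x) ≡ word (proj₁ y) → proj₁ x ≡ proj₁ y
  injective {(t , b) , r} {(t′ , b′) , r′} eq
    with w , p ← sortedRecurrent⇒parse t b r | w′ , p′ ← sortedRecurrent⇒parse t′ b′ r′
    with refl ← trans (sym (parse⇒word t b p)) (trans eq (parse⇒word t′ b′ p′))
    with t≡ , refl ← parse-injective p p′
    = cong (_, b) (Vec.∷ʳ-injectiveˡ t t′ t≡)

  surjective : ∀ (y : Σ[ w ∈ List Step ] Motz m n w) →
               Σ[ x ∈ Σ[ c ∈ Config m (suc n) ] SortedRecurrent c ]
                 (∀ {z : Σ[ c ∈ Config m (suc n) ] SortedRecurrent c} →
                  proj₁ z ≡ proj₁ x → word (proj₁ z) ≡ proj₁ y)
  surjective (w , motz) with t , b , p ← motz⇒parse motz =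
    ((t , b) , parse⇒sortedRecurrent t b p) , λ { refl → parse⇒word t b p }

theorem4p16 : (m n : ℕ) .{{_ : NonZero n}} →
    ((c : Config m n) → SortedRecurrent c →
    fullWord c ≡ word c ∷ʳ D
    × (Σ[ p ∈ IsPolyomino m n (Φ c) ] word c ≡ Ξ (Φ c , p))
    × level c / 1 ≃ Area (word c))
    × BijectionBetween SortedRecurrent (Motz m (n ∸ 1)) (word {m} {n})
theorem4p16 m (suc n) = properties , word-bijection m n
  where
  properties : (c : Config m (suc n)) → SortedRecurrent c →
               fullWord c ≡ word c ∷ʳ D
               × (Σ[ p ∈ IsPolyomino m (suc n) (Φ c) ] word c ≡ Ξ (Φ c , p))
               × level c / 1 ≃ Area (word c)
  properties (t , b) r with sortedRecurrent⇒parse t b r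
  ... | w , p rewrite parse⇒word t b p = parse⇒run p , parse⇒ΞΦ t b p , level≃Area t b p
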